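{- Let $f$ be a fixed nonnegative integer. For every $n$-vertex undirected unweighted graph $G=(V,E)$ and every set of source vertices $S\subseteq V$, there is an $(f+1)$-FT $S\times S$ distance preserver of $G$ with $O\left(n^{2-1/2^f}|S|^{1/2^f}\right)$ edges.
   Context: For $S,T\subseteq V$ and an integer $k\ge 0$, a subgraph $H\subseteq G$ is a $k$-FT $S\times T$ distance preserver if $\mathrm{dist}_{H\setminus F}(s,t)=\mathrm{dist}_{G\setminus F}(s,t)$ for every $s\in S$, $t\in T$ and every edge set $F\subseteq E$ with $|F|\le k$. The constant in the $O(\cdot)$ may depend on $f$. -}

module Defs where

open import Data.Nat using (ℕ; zero; suc; _+_; _*_; _∸_; _^_; _≤_; _<?_)
open import Data.Bool using (Bool; true; false; _∧_; _∨_; not; if_then_else_)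
open import Data.Fin using (Fin; toℕ)
open import Data.Fin.Subset using (Subset; _∈_)
open import Data.List using (List; []; _∷_; length; allFin)
open import Data.Product using (_×_; _,_; Σ; ∃-syntax)
open import Relation.Binary.PropositionalEquality using (_≡_)
open import Relation.Nullary using (¬_; does)
open import Function.Bundles using (_⇔_)
import Data.Fin as F

record Graph (n : ℕ) : Set where
  field
    adj    : Fin n → Fin n → Bool
    sym    : ∀ u v → adj u v ≡ adj v u
    irrefl : ∀ u → adj u u ≡ false
open Graph public

_⊆G_ : ∀ {n} → Graph n → Graph n → Set
H ⊆G G = ∀ u v → adj H u v ≡ true → adj G u v ≡ true

countList : ∀ {A : Set} → (A → Bool) → List A → ℕ
countList p [] = 0
countList p (x ∷ xs) = (if p x then 1 else 0) + countList p xs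

sumList : ∀ {A : Set} → (A → ℕ) → List A → ℕ
sumList g [] = 0
sumList g (x ∷ xs) = g x + sumList g xs

numEdges : ∀ {n} → Graph n → ℕ
numEdges {n} G =
  sumList (λ u → countList (λ v → does (toℕ u <? toℕ v) ∧ adj G u v) (allFin n)) (allFin n)

-- A fault set: a list of edges (pairs of vertices); |F| ≤ k is length F ≤ k.
-- (Lists may mention non-edges or repeat edges; this only yields smaller
--  effective fault sets, so quantifying over such lists is the same as
--  quantifying over edge sets of size ≤ k.)
FaultSet : ℕ → Set
FaultSet n = List (Fin n × Fin n)

isFaulty : ∀ {n} → FaultSet n → Fin n → Fin n → Bool
isFaulty [] u v = false
isFaulty ((a , b) ∷ F) u v =
  (does (a F.≟ u) ∧ does (b F.≟ v)) ∨ (does (a F.≟ v) ∧ does (b F.≟ u)) ∨ isFaulty F u v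

removeAdj : ∀ {n} → Graph n → FaultSet n → Fin n → Fin n → Bool
removeAdj G F u v = adj G u v ∧ not (isFaulty F u v)

data Walk {n : ℕ} (A : Fin n → Fin n → Bool) : Fin n → Fin n → ℕ → Set where
  nil  : ∀ {u} → Walk A u u 0
  cons : ∀ {u w v ℓ} → A u w ≡ true → Walk A w v ℓ → Walk A u v (suc ℓ)

-- dist_A(u,v) = d  (distance is d; if no walk exists the distance is ∞ and
-- IsDist holds for no d).
IsDist : ∀ {n} → (Fin n → Fin n → Bool) → Fin n → Fin n → ℕ → Set
IsDist A u v d = Walk A u v d × (∀ ℓ → Walk A u v ℓ → d ≤ ℓ)

FTPreserver : ∀ {n} → ℕ → Graph n → Graph n → Subset n → Set
FTPreserver {n} k G H S =
  H ⊆G G ×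
  (∀ (F : FaultSet n) → length F ≤ k → ∀ s t → s ∈ S → t ∈ S →
     ∀ d → IsDist (removeAdj H F) s t d ⇔ IsDist (removeAdj G F) s t d)

{-# OPTIONS --safe #-}
-- Ties between shortest paths are broken by weights that are antisymmetric under reversing an edge
-- and make the optimal path π(s,v|F) avoiding a fault set F unique. H consists of the edges of all
-- π(s,v|F) with s ∈ S and |F| ≤ f.
--
-- Preservation: when one more edge e fails, there is a vertex x such that π(s,x|F) and π(t,x|F) both
-- avoid e and together form a shortest s-t path. Otherwise, along a shortest path, π(s,y|F) and
-- π(t,x|F) would both use e for some edge xy; if in the same direction, the lengths contradict each
-- other, and if in opposite directions, exchanging the halves of the two paths contradicts
-- optimality, because the weights of both directions of an edge have a constant sum.
--
-- Size: fix a target b and D with D^(2^f) |S| ≤ 2n; the claim is that the edges entering b number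
-- O(n/D). A path π(s,b|F) is reached by choosing faults one at a time on the current optimal path. If
-- the recorded distances to b can be matched to the thresholds D^(2^0), ..., D^(2^(f-1)), then s and
-- the distances determine the path, and there are O(|S| D^(2^f - 1)) possibilities. Otherwise, for
-- some g < f, at most g faults are nearer to b than t = D^(2^g), and the other faults are irrelevant
-- to the last t vertices of the path. A set R of at most 2n/t vertices meets these last vertices for
-- half of the entering edges, and the claim for g and R applies.
module Submission where

open import Defs
open import Data.Nat using (ℕ; zero; suc; _+_; _*_; _∸_; _^_; _≤_; _<_; z≤n; s≤s; _<?_; _≤?_; _!; >-nonZero)
open import Data.Nat.Properties
open import Data.Nat.Tactic.RingSolver using (solve-∀)
open import Algebra.Bundles using (CommutativeMonoid)
open import Algebra.Properties.CommutativeSemigroup *-commutativeSemigroup using ()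
  renaming (x∙yz≈y∙xz to *-left-comm; interchange to *-interchange)
open import Algebra.Properties.CommutativeSemigroup +-commutativeSemigroup using ()
  renaming (x∙yz≈y∙xz to +-left-comm; interchange to +-interchange)
import Algebra.Solver.CommutativeMonoid as CMSolver
open import Data.Bool using (Bool; true; false; _∧_; _∨_; not; if_then_else_; T; T?)
open import Data.Bool.ListAction using (any)
open import Data.Bool.Properties using (∧-comm; ∨-comm; ∧-conicalˡ; ∧-conicalʳ; ¬-not; not-injective; ⇔→≡) renaming (_≟_ to _≟B_)
open import Data.Empty using (⊥; ⊥-elim)
open import Data.Fin using (Fin; toℕ; combine; remQuot)
open import Data.Fin.Properties using (remQuot-combine; injective⇒≤; toℕ-injective; toℕ≤pred[n]; toℕ<n)
  renaming (_≟_ to _≟F_; any? to anyF?)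
open import Data.Fin.Subset using (Subset; ∣_∣; inside; outside) renaming (_∈_ to _∈S_)
open import Data.Fin.Subset.Properties using (∣p∣≤n)
open import Data.List using (List; []; _∷_; _++_; _∷ʳ_; length; take; drop; cartesianProductWith; cartesianProduct; allFin; filter; filterᵇ; upTo; map)
open import Data.List.Membership.Propositional using (_∈_; find; lose)
open import Data.List.Membership.Propositional.Properties using (∈-cartesianProductWith⁺; ∈-cartesianProduct⁺; ∈-allFin; ∈-∃++; ∈-++⁺ˡ; ∈-++⁺ʳ; ∈-++⁻; ∈-upTo⁺; ∈-insert; ∈-map⁺; ∈-map⁻; ∈-filter⁺; ∈-filter⁻)
open import Data.List.Properties using (length-++; ++-assoc; ++-identityʳ; ∷ʳ-++; take++drop≡id; length-drop; length-map; length-upTo; length-tabulate; filter-notAll; filter-++; filter-reject; ∷-injective; ∷ʳ-injective; ≡-dec)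
open import Data.List.Relation.Unary.All using (All; []; _∷_; all?)
import Data.List.Relation.Unary.All as All
import Data.List.Relation.Unary.All.Properties as All
import Data.List.Relation.Unary.AllPairs.Properties as AllPairs
open import Data.List.Relation.Unary.AllPairs using ([]; _∷_)
open import Data.List.Relation.Unary.Any using (Any; here; there; any?)
import Data.List.Relation.Unary.Any as Any
import Data.List.Relation.Unary.Any.Properties as Any
open import Data.List.Relation.Unary.Unique.Propositional using (Unique)
import Data.List.Relation.Unary.Unique.Propositional.Properties as Unique
open import Data.Product using (_×_; _,_; proj₁; proj₂; ∃; ∃-syntax; ∃₂; uncurry)
open import Data.Sum using (_⊎_; inj₁; inj₂; [_,_]′)
open import Data.Unit using (tt)
open import Data.Vec using (Vec; []; _∷_; zipWith; replicate; tabulate; lookup; head; here; there)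
open import Data.Vec.Properties using (zipWith-comm; zipWith-assoc; zipWith-identityˡ; zipWith-identityʳ; lookup-zipWith; lookup∘tabulate; lookup-replicate; tabulate-cong)
open import Function using (_∘_; id)
open import Function.Bundles using (mk⇔)
open import Relation.Binary.Definitions using (tri<; tri≈; tri>)
open import Relation.Binary.PropositionalEquality renaming (sym to ≡-sym)
open import Relation.Nullary using (¬_; Dec; yes; no; does; contradiction)
open import Relation.Nullary.Decidable using (map′; _×-dec_; dec-true)

-- Lexicographically ordered weights

infixl 6 _⊕_
infix 4 _≺_ _≼_

_⊕_ : ∀ {m} → Vec ℕ m → Vec ℕ m → Vec ℕ m
_⊕_ = zipWith _+_

⊕-commutativeMonoid : ℕ → CommutativeMonoid _ _
⊕-commutativeMonoid m = record
  { Carrier = Vec ℕ m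
  ; _≈_ = _≡_
  ; _∙_ = _⊕_
  ; ε = replicate m 0
  ; isCommutativeMonoid = record
    { isMonoid = record
      { isSemigroup = record
        { isMagma = record { isEquivalence = isEquivalence ; ∙-cong = cong₂ _⊕_ }
        ; assoc = zipWith-assoc +-assoc
        }
      ; identity = zipWith-identityˡ +-identityˡ , zipWith-identityʳ +-identityʳ
      }
    ; comm = zipWith-comm +-comm
    }
  }

_≺_ : ∀ {m} → Vec ℕ m → Vec ℕ m → Set
[]       ≺ []       = ⊥
(x ∷ xs) ≺ (y ∷ ys) = x < y ⊎ (x ≡ y × xs ≺ ys)

_≼_ : ∀ {m} → Vec ℕ m → Vec ℕ m → Set
x ≼ y = x ≺ y ⊎ x ≡ y

≺-irrefl : ∀ {m} (x : Vec ℕ m) → ¬ x ≺ x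
≺-irrefl (x ∷ xs) (inj₁ x<x) = <-irrefl refl x<x
≺-irrefl (x ∷ xs) (inj₂ (_ , xs≺xs)) = ≺-irrefl xs xs≺xs

≺-trans : ∀ {m} {x y z : Vec ℕ m} → x ≺ y → y ≺ z → x ≺ z
≺-trans {x = []} {[]} {[]} ()
≺-trans {x = _ ∷ _} {_ ∷ _} {_ ∷ _} (inj₁ a) (inj₁ b) = inj₁ (<-trans a b)
≺-trans {x = _ ∷ _} {_ ∷ _} {_ ∷ _} (inj₁ a) (inj₂ (refl , _)) = inj₁ a
≺-trans {x = _ ∷ _} {_ ∷ _} {_ ∷ _} (inj₂ (refl , _)) (inj₁ b) = inj₁ b
≺-trans {x = _ ∷ _} {_ ∷ _} {_ ∷ _} (inj₂ (refl , a)) (inj₂ (refl , b)) = inj₂ (refl , ≺-trans a b)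

≼-refl : ∀ {m} {x : Vec ℕ m} → x ≼ x
≼-refl = inj₂ refl

≼-trans : ∀ {m} {x y z : Vec ℕ m} → x ≼ y → y ≼ z → x ≼ z
≼-trans (inj₁ a) (inj₁ b) = inj₁ (≺-trans a b)
≼-trans (inj₁ a) (inj₂ refl) = inj₁ a
≼-trans (inj₂ refl) b = b

≺-≼-trans : ∀ {m} {x y z : Vec ℕ m} → x ≺ y → y ≼ z → x ≺ z
≺-≼-trans a (inj₁ b) = ≺-trans a b
≺-≼-trans a (inj₂ refl) = a

≼⇒⊁ : ∀ {m} {x y : Vec ℕ m} → x ≼ y → ¬ y ≺ x
≼⇒⊁ x≼y y≺x = ≺-irrefl _ (≺-≼-trans y≺x x≼y)

≼-antisym : ∀ {m} {x y : Vec ℕ m} → x ≼ y → y ≼ x → x ≡ y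
≼-antisym (inj₁ a) b = contradiction a (≼⇒⊁ b)
≼-antisym (inj₂ e) b = e

≼-total : ∀ {m} (x y : Vec ℕ m) → x ≼ y ⊎ y ≺ x
≼-total [] [] = inj₁ ≼-refl
≼-total (x ∷ xs) (y ∷ ys) with <-cmp x y
... | tri< x<y _ _ = inj₁ (inj₁ (inj₁ x<y))
... | tri> _ _ y<x = inj₂ (inj₁ y<x)
... | tri≈ _ refl _ with ≼-total xs ys
...   | inj₁ (inj₁ a) = inj₁ (inj₁ (inj₂ (refl , a)))
...   | inj₁ (inj₂ refl) = inj₁ ≼-refl
...   | inj₂ b = inj₂ (inj₂ (refl , b))

⊕-monoʳ-≺ : ∀ {m} (z : Vec ℕ m) {x y} → x ≺ y → z ⊕ x ≺ z ⊕ y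
⊕-monoʳ-≺ [] {[]} {[]} ()
⊕-monoʳ-≺ (c ∷ z) {_ ∷ _} {_ ∷ _} (inj₁ a) = inj₁ (+-monoʳ-< c a)
⊕-monoʳ-≺ (c ∷ z) {_ ∷ _} {_ ∷ _} (inj₂ (refl , a)) = inj₂ (refl , ⊕-monoʳ-≺ z a)

⊕-monoˡ-≺ : ∀ {m} (z : Vec ℕ m) {x y} → x ≺ y → x ⊕ z ≺ y ⊕ z
⊕-monoˡ-≺ z {x} {y} a = subst₂ _≺_ (zipWith-comm +-comm z x) (zipWith-comm +-comm z y) (⊕-monoʳ-≺ z a)

⊕-mono-≼ : ∀ {m} {x y x′ y′ : Vec ℕ m} → x ≼ y → x′ ≼ y′ → x ⊕ x′ ≼ y ⊕ y′
⊕-mono-≼ {y = y} {x′ = x′} p q = ≼-trans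
  ([ inj₁ ∘ ⊕-monoˡ-≺ x′ , inj₂ ∘ cong (_⊕ x′) ]′ p)
  ([ inj₁ ∘ ⊕-monoʳ-≺ y , inj₂ ∘ cong (y ⊕_) ]′ q)

⊕-mono-≺-≼ : ∀ {m} {x y x′ y′ : Vec ℕ m} → x ≺ y → x′ ≼ y′ → x ⊕ x′ ≺ y ⊕ y′
⊕-mono-≺-≼ {x′ = x′} p q = ≺-≼-trans (⊕-monoˡ-≺ x′ p) (⊕-mono-≼ ≼-refl q)

⊕-cancelʳ-≼ : ∀ {m} (z : Vec ℕ m) {x y} → x ⊕ z ≼ y ⊕ z → x ≼ y
⊕-cancelʳ-≼ z {x} {y} p with ≼-total x y
... | inj₁ q = q
... | inj₂ y≺x = contradiction (⊕-monoˡ-≺ z y≺x) (≼⇒⊁ p)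

⊕-cancelˡ-≼ : ∀ {m} (z : Vec ℕ m) {x y} → z ⊕ x ≼ z ⊕ y → x ≼ y
⊕-cancelˡ-≼ z {x} {y} p with ≼-total x y
... | inj₁ q = q
... | inj₂ y≺x = contradiction (⊕-monoʳ-≺ z y≺x) (≼⇒⊁ p)

-- The head coordinate counts edges and is compared first, so an optimal path is also a shortest
-- one.
head-mono : ∀ {m} {x y : Vec ℕ (suc m)} → x ≼ y → head x ≤ head y
head-mono {x = _ ∷ _} {_ ∷ _} (inj₁ (inj₁ a)) = <⇒≤ a
head-mono {x = _ ∷ _} {_ ∷ _} (inj₁ (inj₂ (refl , _))) = ≤-refl
head-mono {x = _ ∷ _} {_ ∷ _} (inj₂ refl) = ≤-refl

-- An edge weighs 1 at the length coordinate; at the coordinate of (x , y) it weighs 2 if traversed from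
-- x to y, 0 if traversed from y to x, and 1 if it is another edge: ±1 perturbations shifted into ℕ.
tilt : Bool → Bool → ℕ
tilt true  false = 2
tilt false true  = 0
tilt _     _     = 1

tilt-antisym : ∀ p q → tilt p q + tilt q p ≡ 2
tilt-antisym true  true  = refl
tilt-antisym true  false = refl
tilt-antisym false true  = refl
tilt-antisym false false = refl

sameArc : ∀ {n} → Fin n × Fin n → Fin n × Fin n → Bool
sameArc (u , w) (x , y) = does (u ≟F x) ∧ does (w ≟F y)

turn : ∀ {n} → Fin n → Fin n → Fin n × Fin n → ℕ
turn u w (x , y) = tilt (sameArc (u , w) (x , y)) (sameArc (u , w) (y , x))

edgeWeight : ∀ {n} → Fin n → Fin n → Vec ℕ (suc (n * n))
edgeWeight {n} u w = 1 ∷ tabulate (λ i → turn u w (remQuot n i))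

pathWeight : ∀ {n} → Fin n → List (Fin n) → Vec ℕ (suc (n * n))
pathWeight u []      = replicate _ 0
pathWeight u (w ∷ P) = edgeWeight u w ⊕ pathWeight w P

turn-antisym : ∀ {n} (u w : Fin n) xy → turn u w xy + turn w u xy ≡ 2
turn-antisym u w (x , y) = trans
  (cong₂ (λ p q → turn u w (x , y) + tilt p q)
    (∧-comm (does (w ≟F x)) (does (u ≟F y))) (∧-comm (does (w ≟F y)) (does (u ≟F x))))
  (tilt-antisym (sameArc (u , w) (x , y)) (sameArc (u , w) (y , x)))

zipWith-tabulate : ∀ {m} (f g : Fin m → ℕ) → tabulate f ⊕ tabulate g ≡ tabulate (λ i → f i + g i)
zipWith-tabulate {zero}  f g = refl
zipWith-tabulate {suc m} f g = cong (f Fin.zero + g Fin.zero ∷_) (zipWith-tabulate (f ∘ Fin.suc) (g ∘ Fin.suc))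

-- The two directions of any edge together weigh 2 at every coordinate, whichever edge it is; this
-- lets `exchange` trade one edge for another.
edgeWeight-antisym : ∀ {n} (u w x y : Fin n) →
  edgeWeight u w ⊕ edgeWeight w u ≡ edgeWeight x y ⊕ edgeWeight y x
edgeWeight-antisym {n} u w x y = cong (2 ∷_) (begin
  tabulate (λ i → turn u w (remQuot n i)) ⊕ tabulate (λ i → turn w u (remQuot n i))
    ≡⟨ zipWith-tabulate {n * n} _ _ ⟩
  tabulate (λ i → turn u w (remQuot n i) + turn w u (remQuot n i))
    ≡⟨ tabulate-cong (λ i → trans (turn-antisym u w (remQuot n i)) (≡-sym (turn-antisym x y (remQuot n i)))) ⟩
  tabulate (λ i → turn x y (remQuot n i) + turn y x (remQuot n i))
    ≡⟨ zipWith-tabulate {n * n} _ _ ⟨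
  tabulate (λ i → turn x y (remQuot n i)) ⊕ tabulate (λ i → turn y x (remQuot n i)) ∎)
  where open ≡-Reasoning

head-pathWeight : ∀ {n} (u : Fin n) P → head (pathWeight u P) ≡ length P
head-pathWeight u []      = refl
head-pathWeight u (w ∷ P) with pathWeight w P | head-pathWeight w P
... | _ ∷ _ | eq = cong suc eq

-- Optimal paths

-- Paths are kept as raw vertex lists (the start vertex is not in the list), so that the
-- same list can be a path of several subgraphs at once.
data Path {n} (A : Fin n → Fin n → Bool) : Fin n → List (Fin n) → Fin n → Set where
  []  : ∀ {u} → Path A u [] u
  _∷_ : ∀ {u w v P} → A u w ≡ true → Path A w P v → Path A u (w ∷ P) v

infix 4 _⊑_
_⊑_ : ∀ {n} → (A B : Fin n → Fin n → Bool) → Set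
A ⊑ B = ∀ x y → A x y ≡ true → B x y ≡ true

Path-⊑ : ∀ {n} {A B : Fin n → Fin n → Bool} → A ⊑ B → ∀ {u P v} → Path A u P v → Path B u P v
Path-⊑ A⊑B []      = []
Path-⊑ A⊑B (e ∷ p) = A⊑B _ _ e ∷ Path-⊑ A⊑B p

Path-++ : ∀ {n} {A : Fin n → Fin n → Bool} {u P v Q w} → Path A u P v → Path A v Q w → Path A u (P ++ Q) w
Path-++ []      q = q
Path-++ (e ∷ p) q = e ∷ Path-++ p q

Path-split : ∀ {n} {A : Fin n → Fin n → Bool} {u v} P {Q} → Path A u (P ++ Q) v →
  ∃ λ w → Path A u P w × Path A w Q v
Path-split []      q = _ , [] , q
Path-split (_ ∷ P) (e ∷ p) with Path-split P p
... | w , p₁ , p₂ = w , e ∷ p₁ , p₂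

Path-end-unique : ∀ {n} {A B : Fin n → Fin n → Bool} {u P v w} → Path A u P v → Path B u P w → v ≡ w
Path-end-unique []      []      = refl
Path-end-unique (_ ∷ p) (_ ∷ q) = Path-end-unique p q

Path-reverse : ∀ {n} {A : Fin n → Fin n → Bool} → (∀ x y → A x y ≡ A y x) → ∀ {u P v} → Path A u P v →
  ∃ λ Q → Path A v Q u × length Q ≡ length P
Path-reverse A-sym [] = [] , [] , refl
Path-reverse A-sym {u} (_∷_ {w = w} {P = P} e p) with Path-reverse A-sym p
... | Q , q , ≡len = Q ∷ʳ u , Path-++ q (trans (A-sym w u) e ∷ []) ,
  trans (length-++ Q) (trans (+-comm (length Q) 1) (cong suc ≡len))

pathWeight-++ : ∀ {n} {A : Fin n → Fin n → Bool} {u P w} → Path A u P w → ∀ Q →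
  pathWeight u (P ++ Q) ≡ pathWeight u P ⊕ pathWeight w Q
pathWeight-++ []                Q = ≡-sym (zipWith-identityˡ +-identityˡ _)
pathWeight-++ (_∷_ {u = u} {w} _ p) Q =
  trans (cong (edgeWeight u w ⊕_) (pathWeight-++ p Q)) (≡-sym (zipWith-assoc +-assoc _ _ _))

record Best {n} (A : Fin n → Fin n → Bool) (u v : Fin n) (P : List (Fin n)) : Set where
  constructor best
  field
    path    : Path A u P v
    minimal : ∀ {Q} → Path A u Q v → pathWeight u P ≼ pathWeight u Q
open Best

Best-length : ∀ {n} {A : Fin n → Fin n → Bool} {u v P Q} → Best A u v P → Path A u Q v → length P ≤ length Q
Best-length {u = u} {P = P} {Q} b q =
  subst₂ _≤_ (head-pathWeight u P) (head-pathWeight u Q) (head-mono (minimal b q))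

-- A smaller graph has fewer competitors. With `Best-unique` this identifies the optimal paths of
-- two nested graphs once that of the larger survives in the smaller.
Best-⊑ : ∀ {n} {A B : Fin n → Fin n → Bool} → B ⊑ A → ∀ {u v P} → Best A u v P → Path B u P v → Best B u v P
Best-⊑ B⊑A b p = best p (λ q → minimal b (Path-⊑ B⊑A q))

Best-[] : ∀ {n} {A : Fin n → Fin n → Bool} {u} → Best A u u []
Best-[] = best [] (λ _ → 0≼ _)
  where
  0≼ : ∀ {m} (x : Vec ℕ m) → replicate m 0 ≼ x
  0≼ [] = ≼-refl
  0≼ (zero ∷ x) with 0≼ x
  ... | inj₁ a = inj₁ (inj₂ (refl , a))
  ... | inj₂ e = inj₂ (cong (0 ∷_) e)
  0≼ (suc _ ∷ x) = inj₁ (inj₁ (s≤s z≤n))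

-- Weight is additive under concatenation and the order is cancellative, so a better piece would
-- improve the whole path.
Best-split : ∀ {n} {A : Fin n → Fin n → Bool} {u v} P {Q} → Best A u v (P ++ Q) →
  ∃ λ w → Best A u w P × Best A w v Q
Best-split {u = u} P {Q} (best p m) with Path-split P p
... | w , p₁ , p₂ = w
  , best p₁ (λ q → ⊕-cancelʳ-≼ _ (subst₂ _≼_ (pathWeight-++ p₁ Q) (pathWeight-++ q Q) (m (Path-++ q p₂))))
  , best p₂ (λ {R} q → ⊕-cancelˡ-≼ (pathWeight u P)
      (subst₂ _≼_ (pathWeight-++ p₁ Q) (pathWeight-++ p₁ R) (m (Path-++ p₁ q))))

Best-loopless : ∀ {n} {A : Fin n → Fin n → Bool} {u v} P {Q} → Best A u v (P ++ Q) → Path A u P u → P ≡ []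
Best-loopless []      b p = refl
Best-loopless (w ∷ P) {Q} b p with Path-split (w ∷ P) (path b)
... | x , p₁ , p₂ rewrite Path-end-unique p p₁ =
  contradiction (≤-trans (s≤s (m≤n+m (length Q) (length P))) (subst (_≤ length Q) (cong suc (length-++ P)) (Best-length b p₂))) (<-irrefl refl)

-- Fault sets as sets of undirected edges

infixl 6 _∖_
_∖_ : ∀ {n} → (Fin n → Fin n → Bool) → FaultSet n → Fin n → Fin n → Bool
(A ∖ F) u v = A u v ∧ not (isFaulty F u v)

SameEdge : ∀ {n} → Fin n × Fin n → Fin n → Fin n → Set
SameEdge (a , b) u v = (a ≡ u × b ≡ v) ⊎ (a ≡ v × b ≡ u)

sameArc⁻ : ∀ {n} (a b u v : Fin n) → sameArc (a , b) (u , v) ≡ true → a ≡ u × b ≡ v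
sameArc⁻ a b u v eq with a ≟F u | b ≟F v
... | yes p | yes q = p , q
sameArc⁻ _ _ _ _ () | yes _ | no _
sameArc⁻ _ _ _ _ () | no _  | _

sameArc⁺ : ∀ {n} (a b : Fin n) → sameArc (a , b) (a , b) ≡ true
sameArc⁺ a b with a ≟F a | b ≟F b
... | yes _ | yes _ = refl
... | no ¬p | _     = contradiction refl ¬p
... | yes _ | no ¬q = contradiction refl ¬q

isFaulty⁻ : ∀ {n} (F : FaultSet n) {u v} → isFaulty F u v ≡ true → ∃ λ e → e ∈ F × SameEdge e u v
isFaulty⁻ ((a , b) ∷ F) {u} {v} eq
  with sameArc (a , b) (u , v) in p | sameArc (a , b) (v , u) in q
... | true  | _     = _ , here refl , inj₁ (sameArc⁻ a b u v p)
... | false | true  = _ , here refl , inj₂ (sameArc⁻ a b v u q)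
... | false | false with isFaulty⁻ F eq
...   | e , e∈F , same = e , there e∈F , same

isFaulty⁺ : ∀ {n} {F : FaultSet n} {e u v} → e ∈ F → SameEdge e u v → isFaulty F u v ≡ true
isFaulty⁺ {e = a , b} (here refl) (inj₁ (refl , refl)) rewrite sameArc⁺ a b = refl
isFaulty⁺ {e = a , b} (here refl) (inj₂ (refl , refl)) rewrite sameArc⁺ a b
  with sameArc (a , b) (b , a)
... | true  = refl
... | false = refl
isFaulty⁺ {F = (c , d) ∷ _} {u = u} {v} (there e∈F) same
  with sameArc (c , d) (u , v) | sameArc (c , d) (v , u)
... | true  | _     = refl
... | false | true  = refl
... | false | false = isFaulty⁺ e∈F same

SameEdge-swap : ∀ {n} {e : Fin n × Fin n} {u v} → SameEdge e u v → SameEdge e v u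
SameEdge-swap (inj₁ p) = inj₂ p
SameEdge-swap (inj₂ p) = inj₁ p

isFaulty-sym : ∀ {n} (F : FaultSet n) u v → isFaulty F u v ≡ isFaulty F v u
isFaulty-sym F u v = ⇔→≡ {z = true} (mk⇔ (swap u v) (swap v u))
  where
  swap : ∀ u v → isFaulty F u v ≡ true → isFaulty F v u ≡ true
  swap u v eq with isFaulty⁻ F eq
  ... | e , e∈F , same = isFaulty⁺ e∈F (SameEdge-swap same)

∖⁺ : ∀ {n} (A : Fin n → Fin n → Bool) F {u v} → A u v ≡ true → isFaulty F u v ≡ false → (A ∖ F) u v ≡ true
∖⁺ A F a f rewrite a | f = refl

∖⁻ : ∀ {n} (A : Fin n → Fin n → Bool) F {u v} → (A ∖ F) u v ≡ true → A u v ≡ true × isFaulty F u v ≡ false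
∖⁻ A F eq = ∧-conicalˡ _ _ eq , not-injective (∧-conicalʳ _ _ eq)

∖-⊑ : ∀ {n} {A : Fin n → Fin n → Bool} F → A ∖ F ⊑ A
∖-⊑ {A = A} F u v eq = proj₁ (∖⁻ A F eq)

infix 4 _⊆F_
-- Compares undirected edges instead of list entries, since a fault may be listed in the other
-- direction, as happens in `Chain-exists`.
_⊆F_ : ∀ {n} → FaultSet n → FaultSet n → Set
F ⊆F K = ∀ u v → isFaulty F u v ≡ true → isFaulty K u v ≡ true

∖-antitone : ∀ {n} {A : Fin n → Fin n → Bool} F K → F ⊆F K → A ∖ K ⊑ A ∖ F
∖-antitone {A = A} F K F⊆K u v eq with ∖⁻ A K eq
... | a , k = ∖⁺ A F a (¬-not (λ f → contradiction (trans (≡-sym k) (F⊆K u v f)) (λ ())))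

∖-sym : ∀ {n} {A : Fin n → Fin n → Bool} → (∀ u v → A u v ≡ A v u) → ∀ F u v → (A ∖ F) u v ≡ (A ∖ F) v u
∖-sym A-sym F u v = cong₂ (λ p q → p ∧ not q) (A-sym u v) (isFaulty-sym F u v)

-- The last faulty edge of a path.
record Hit {n} (A : Fin n → Fin n → Bool) (F : FaultSet n) (u v : Fin n) (P : List (Fin n)) : Set where
  constructor hit
  field
    {tail head′} : Fin n
    before       : List (Fin n)
    after        : List (Fin n)
    splits       : P ≡ before ++ head′ ∷ after
    path-before  : Path A u before tail
    edge         : A tail head′ ≡ true
    faulty       : isFaulty F tail head′ ≡ true
    path-after   : Path (A ∖ F) head′ after v

scan : ∀ {n} {A : Fin n → Fin n → Bool} F {u v P} → Path A u P v → Path (A ∖ F) u P v ⊎ Hit A F u v P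
scan F [] = inj₁ []
scan {A = A} F (_∷_ {u} {w} {P = P} e p) with scan F p
... | inj₂ (hit Q R eq q e′ f r) = inj₂ (hit (w ∷ Q) R (cong (w ∷_) eq) (e ∷ q) e′ f r)
... | inj₁ p′ with isFaulty F u w in f
...   | true  = inj₂ (hit [] P refl [] e f p′)
...   | false = inj₁ (∖⁺ A F e f ∷ p′)

turn-elsewhere : ∀ {n} (s a x y : Fin n) → isFaulty ((s , a) ∷ []) x y ≡ false → turn x y (s , a) ≡ 1
turn-elsewhere s a x y eq with sameArc (x , y) (s , a) in p | sameArc (x , y) (a , s) in q
... | false | false = refl
... | true  | _ with sameArc⁻ x y s a p
...   | refl , refl = contradiction (trans (≡-sym eq) (isFaulty⁺ {F = (x , y) ∷ []} (here refl) (inj₁ (refl , refl)))) (λ ())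
turn-elsewhere s a x y eq | false | true with sameArc⁻ x y a s q
...   | refl , refl = contradiction (trans (≡-sym eq) (isFaulty⁺ {F = (y , x) ∷ []} (here refl) (inj₂ (refl , refl)))) (λ ())

lookup-edgeWeight : ∀ {n} (x y s a : Fin n) → lookup (edgeWeight x y) (Fin.suc (combine s a)) ≡ turn x y (s , a)
lookup-edgeWeight {n} x y s a = trans (lookup∘tabulate _ (combine s a)) (cong (turn x y) (remQuot-combine s a))

lookup-pathWeight-∷ : ∀ {n} (u w : Fin n) P s a →
  lookup (pathWeight u (w ∷ P)) (Fin.suc (combine s a)) ≡ turn u w (s , a) + lookup (pathWeight w P) (Fin.suc (combine s a))
lookup-pathWeight-∷ u w P s a =
  trans (lookup-zipWith _+_ (Fin.suc (combine s a)) (edgeWeight u w) (pathWeight w P)) (cong (_+ _) (lookup-edgeWeight u w s a))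

-- Each step off the edge `sa` contributes 1 there, so the coordinate repeats the length; only a
-- path through that edge can deviate.
lookup-elsewhere : ∀ {n} {A : Fin n → Fin n → Bool} {s a u P v} → Path (A ∖ ((s , a) ∷ [])) u P v →
  lookup (pathWeight u P) (Fin.suc (combine s a)) ≡ length P
lookup-elsewhere {n} {s = s} {a} [] = lookup-replicate (combine s a) 0
lookup-elsewhere {A = A} {s} {a} (_∷_ {u} {w} {P = P} e p) = trans (lookup-pathWeight-∷ u w P s a)
  (cong₂ _+_ (turn-elsewhere s a u w (proj₂ (∖⁻ A ((s , a) ∷ []) e))) (lookup-elsewhere p))

turn-self : ∀ {n} {u a : Fin n} → u ≢ a → turn u a (u , a) ≡ 2
turn-self {u = u} {a} u≢a rewrite sameArc⁺ u a with sameArc (u , a) (a , u) in q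
... | false = refl
... | true  = contradiction (proj₁ (sameArc⁻ u a a u q)) u≢a

-- Two optimal paths that first diverge at u, along the edges ua and ub, weigh differently at the
-- coordinate of ua: only the first path uses that edge, since optimal paths revisit no vertex.
Best-diverge : ∀ {n} {A : Fin n → Fin n → Bool} {u v a b P Q} →
  Best A u v (a ∷ P) → Best A u v (b ∷ Q) → a ≡ b
Best-diverge {A = A} {u} {v} {a} {b} {P} {Q} bp bq with a ≟F b
... | yes a≡b = a≡b
... | no a≢b = contradiction 2+≡1+ (λ eq → 1+n≢n (suc-injective (trans eq (cong suc (≡-sym ≡length)))))
  where
  ≡weight : pathWeight u (a ∷ P) ≡ pathWeight u (b ∷ Q)
  ≡weight = ≼-antisym (minimal bp (path bq)) (minimal bq (path bp))

  ≡length : length P ≡ length Q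
  ≡length = suc-injective (trans (≡-sym (head-pathWeight u (a ∷ P))) (trans (cong head ≡weight) (head-pathWeight u (b ∷ Q))))

  K : FaultSet _
  K = (u , a) ∷ []

  u≢a : u ≢ a
  u≢a refl with path bp
  ... | e ∷ _ = contradiction (Best-loopless (a ∷ []) bp (e ∷ [])) (λ ())

  faulty-ua : ∀ {x y} → isFaulty K x y ≡ true → SameEdge (u , a) x y
  faulty-ua f with isFaulty⁻ K f
  ... | _ , here refl , same = same

  -- A second use of the edge, in either direction, would bring the path back to `u`.
  cleanP : Path (A ∖ K) a P v
  cleanP with path bp
  ... | e ∷ p with scan K p
  ...   | inj₁ p′ = p′
  ...   | inj₂ (hit p₁ p₂ refl q e′ f _) with faulty-ua f
  ...     | inj₁ (refl , _) = contradiction (Best-loopless (a ∷ p₁) bp (e ∷ q)) (λ ())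
  ...     | inj₂ (refl , refl) = contradiction
              (Best-loopless (a ∷ p₁ ∷ʳ u) (subst (λ R → Best A u v (a ∷ R)) (≡-sym (∷ʳ-++ p₁ _ _)) bp) (e ∷ Path-++ q (e′ ∷ []))) (λ ())

  ∷ʳ≢[] : ∀ {xs : List (Fin _)} {x} → xs ∷ʳ x ≢ []
  ∷ʳ≢[] {[]} ()
  ∷ʳ≢[] {_ ∷ _} ()

  cleanQ : Path (A ∖ K) u (b ∷ Q) v
  cleanQ with scan K (path bq)
  ... | inj₁ q′ = q′
  ... | inj₂ (hit q₁ q₂ eq q e′ f _) with faulty-ua f
  ...   | inj₂ (refl , refl) = contradiction
            (Best-loopless (q₁ ∷ʳ u) (subst (Best A u v) (trans eq (≡-sym (∷ʳ-++ q₁ _ _))) bq) (Path-++ q (e′ ∷ []))) ∷ʳ≢[]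
  -- Using `ua` later than at the start means a return to `u`; using it at the start means that `a`
  -- and `b` agree.
  ...   | inj₁ (refl , refl) with Best-loopless q₁ (subst (Best A u v) eq bq) q
  cleanQ | inj₂ (hit .[] q₂ refl q e′ f _) | inj₁ (refl , refl) | refl = contradiction refl a≢b

  c : Fin _
  c = Fin.suc (combine u a)

  -- The step `ua` counts 2 and every other step of either path counts 1, yet both paths have the
  -- same length and the same weight.
  2+≡1+ : suc (suc (length P)) ≡ suc (length Q)
  2+≡1+ = begin
    2 + length P                                          ≡⟨ cong₂ _+_ (turn-self u≢a) (lookup-elsewhere cleanP) ⟨
    turn u a (u , a) + lookup (pathWeight a P) c          ≡⟨ lookup-pathWeight-∷ u a P u a ⟨
    lookup (pathWeight u (a ∷ P)) c                       ≡⟨ cong (λ w → lookup w c) ≡weight ⟩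
    lookup (pathWeight u (b ∷ Q)) c                       ≡⟨ lookup-elsewhere cleanQ ⟩
    1 + length Q                                          ∎
    where open ≡-Reasoning

Best-tail : ∀ {n} {A : Fin n → Fin n → Bool} {u v a P} → Best A u v (a ∷ P) → Best A a v P
Best-tail {a = a} b with Best-split (a ∷ []) b
... | _ , best (_ ∷ []) _ , b′ = b′

Best-unique : ∀ {n} {A : Fin n → Fin n → Bool} {u v P Q} → Best A u v P → Best A u v Q → P ≡ Q
Best-unique {P = []}    {[]}    bp bq = refl
Best-unique {P = []}    {_ ∷ _} bp bq = contradiction (Best-length bq (path bp)) (λ ())
Best-unique {P = _ ∷ _} {[]}    bp bq = contradiction (Best-length bp (path bq)) (λ ())
Best-unique {P = a ∷ P} {b ∷ Q} bp bq with Best-diverge bp bq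
... | refl = cong (a ∷_) (Best-unique (Best-tail bp) (Best-tail bq))

-- Existence and decidability by exhaustive search

listsUpTo : ∀ {A : Set} → List A → ℕ → List (List A)
listsUpTo xs zero    = [] ∷ []
listsUpTo xs (suc k) = [] ∷ cartesianProductWith _∷_ xs (listsUpTo xs k)

∈-listsUpTo : ∀ {A : Set} {xs : List A} → (∀ x → x ∈ xs) → ∀ {k} ys → length ys ≤ k → ys ∈ listsUpTo xs k
∈-listsUpTo all∈ {zero}  []       _         = here refl
∈-listsUpTo all∈ {suc k} []       _         = here refl
∈-listsUpTo all∈ {suc k} (y ∷ ys) (s≤s len) =
  there (∈-cartesianProductWith⁺ _∷_ (all∈ y) (∈-listsUpTo all∈ ys len))

path? : ∀ {n} (A : Fin n → Fin n → Bool) u P v → Dec (Path A u P v)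
path? A u []      v = map′ (λ { refl → [] }) (λ { [] → refl }) (u ≟F v)
path? A u (w ∷ P) v with A u w ≟B true | path? A w P v
... | yes e | yes p = yes (e ∷ p)
... | no ¬e | _     = no (λ { (e ∷ _) → ¬e e })
... | yes _ | no ¬p = no (λ { (_ ∷ p) → ¬p p })

argmin : ∀ {A : Set} {m} (w : A → Vec ℕ m) {Q : A → Set} → (∀ x → Dec (Q x)) → ∀ xs {x} → x ∈ xs → Q x →
  ∃ λ y → Q y × (∀ {z} → z ∈ xs → Q z → w y ≼ w z)
argmin w {Q} Q? (x ∷ xs) x∈ qx with any? Q? xs
... | no ¬q = x , qx′ x∈ qx , λ { (here refl) _ → ≼-refl ; (there z∈) qz → contradiction (lose z∈ qz) ¬q }
  where
  qx′ : ∀ {y} → y ∈ x ∷ xs → Q y → Q x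
  qx′ (here refl) q = q
  qx′ (there y∈)  q = contradiction (lose y∈ q) ¬q
... | yes a with find a
...   | z , z∈ , qz with argmin w Q? xs z∈ qz | Q? x
...     | y , qy , min | no ¬qx = y , qy , λ { (here refl) q → contradiction q ¬qx ; (there z∈) q → min z∈ q }
...     | y , qy , min | yes qx with ≼-total (w y) (w x)
...       | inj₁ y≼x = y , qy , λ { (here refl) _ → y≼x ; (there z∈) q → min z∈ q }
...       | inj₂ x≺y = x , qx , λ { (here refl) _ → ≼-refl ; (there z∈) q → ≼-trans (inj₁ x≺y) (min z∈ q) }

-- A given path bounds the search: among the finitely many lists that are not longer there is a
-- lightest path, and longer ones lose at the head coordinate.
Best-exists : ∀ {n} {A : Fin n → Fin n → Bool} {u v Q} → Path A u Q v → ∃ (Best A u v)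
Best-exists {n} {A} {u} {v} {Q} q
  with argmin (pathWeight u) (λ P → path? A u P v) (listsUpTo (allFin n) (length Q)) (∈-listsUpTo ∈-allFin Q ≤-refl) q
... | P , p , min = P , best p λ {R} r → helper R r
  where
  ≼-shorter : ∀ R → length Q < length R → pathWeight u Q ≼ pathWeight u R
  ≼-shorter R Q<R with ≼-total (pathWeight u Q) (pathWeight u R)
  ... | inj₁ a = a
  ... | inj₂ a = contradiction (subst₂ _≤_ (head-pathWeight u R) (head-pathWeight u Q) (head-mono (inj₁ a))) (<⇒≱ Q<R)

  helper : ∀ R → Path A u R v → pathWeight u P ≼ pathWeight u R
  helper R r with ≤-<-connex (length R) (length Q)
  ... | inj₁ R≤Q = min (∈-listsUpTo ∈-allFin R R≤Q) r
  ... | inj₂ Q<R = ≼-trans (min (∈-listsUpTo ∈-allFin Q ≤-refl) q) (≼-shorter R Q<R)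

record Suffix {n} (A : Fin n → Fin n → Bool) (u v : Fin n) (P : List (Fin n)) (j : ℕ) : Set where
  constructor suffix
  field
    {vertex}     : Fin n
    front back   : List (Fin n)
    splits       : P ≡ front ++ back
    length-back  : length back ≡ j
    best-front   : Best A u vertex front
    best-back    : Best A vertex v back

Best-suffix : ∀ {n} {A : Fin n → Fin n → Bool} {u v P} → Best A u v P → ∀ {j} → j ≤ length P → Suffix A u v P j
Best-suffix {P = P} b {j} j≤ with Best-split (take (length P ∸ j) P) (subst (Best _ _ _) (≡-sym (take++drop≡id (length P ∸ j) P)) b)
... | r , b₁ , b₂ = suffix _ _ (≡-sym (take++drop≡id (length P ∸ j) P))
  (trans (length-drop (length P ∸ j) P) (m∸[m∸n]≡n j≤)) b₁ b₂

-- A vertex has only one optimal path to `v`, so it cannot occur at two distances from `v`. This is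
-- also what makes the sources of a `Spread` distinct.
Suffix-injective : ∀ {n} {A : Fin n → Fin n → Bool} {u v P i j} (s : Suffix A u v P i) (t : Suffix A u v P j) →
  Suffix.vertex s ≡ Suffix.vertex t → i ≡ j
Suffix-injective (suffix _ _ _ len _ b) (suffix _ _ _ len′ _ b′) refl =
  trans (≡-sym len) (trans (cong length (Best-unique b b′)) len′)

-- The suffixes of lengths 0 to `length P` start at distinct vertices. This bounds the search in
-- `best?`.
Best-length< : ∀ {n} {A : Fin n → Fin n → Bool} {u v P} → Best A u v P → length P < n
Best-length< {P = P} b = injective⇒≤ {f = λ i → Suffix.vertex (at i)} (λ {i} {j} eq → toℕ-injective (Suffix-injective (at i) (at j) eq))
  where
  at : (i : Fin (suc (length P))) → Suffix _ _ _ P (toℕ i)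
  at i = Best-suffix b (toℕ≤pred[n] i)

best? : ∀ {n} (A : Fin n → Fin n → Bool) u v → Dec (∃ (Best A u v))
best? {n} A u v with any? (λ P → path? A u P v) (listsUpTo (allFin n) n)
... | yes a with find a
...   | _ , _ , p = yes (Best-exists p)
best? {n} A u v | no ¬a = no λ { (P , b) → ¬a (lose (∈-listsUpTo ∈-allFin P (<⇒≤ (Best-length< b))) (path b)) }

-- Restoration after one more fault

Best-drop : ∀ {n} {A : Fin n → Fin n → Bool} {u v w} P {Q} → Best A u v (P ++ Q) → Path A u P w → Best A w v Q
Best-drop P b p with Best-split P b
... | _ , b₁ , b₂ rewrite Path-end-unique p (path b₁) = b₂

Hit⇒¬Path : ∀ {n} {A : Fin n → Fin n → Bool} {F u v P} → Hit A F u v P → ¬ Path (A ∖ F) u P v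
Hit⇒¬Path {A = A} {F} (hit before after refl p _ f _) q with Path-split before q
... | w , q₁ , e ∷ _ rewrite Path-end-unique p q₁ =
  contradiction (trans (≡-sym f) (proj₂ (∖⁻ A F e))) (λ ())

SameEdge-same : ∀ {n} {e : Fin n × Fin n} {x y x′ y′} → SameEdge e x y → SameEdge e x′ y′ →
  (x′ ≡ x × y′ ≡ y) ⊎ (x′ ≡ y × y′ ≡ x)
SameEdge-same (inj₁ (refl , refl)) (inj₁ (refl , refl)) = inj₁ (refl , refl)
SameEdge-same (inj₁ (refl , refl)) (inj₂ (refl , refl)) = inj₂ (refl , refl)
SameEdge-same (inj₂ (refl , refl)) (inj₁ (refl , refl)) = inj₂ (refl , refl)
SameEdge-same (inj₂ (refl , refl)) (inj₂ (refl , refl)) = inj₁ (refl , refl)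

faulty-same : ∀ {n} {e : Fin n × Fin n} {x y x′ y′} → isFaulty (e ∷ []) x y ≡ true → isFaulty (e ∷ []) x′ y′ ≡ true →
  (x′ ≡ x × y′ ≡ y) ⊎ (x′ ≡ y × y′ ≡ x)
faulty-same {e = e} f f′ with isFaulty⁻ (e ∷ []) f | isFaulty⁻ (e ∷ []) f′
... | _ , here refl , s | _ , here refl , s′ = SameEdge-same s s′

-- An optimal path uses `e` only once, since a second use in either direction closes a loop; so the
-- part before the last use avoids `e` as well.
Hit-before : ∀ {n} {A : Fin n → Fin n → Bool} {e u v P} → Best A u v P → (h : Hit A (e ∷ []) u v P) →
  Path (A ∖ (e ∷ [])) u (Hit.before h) (Hit.tail h)
Hit-before {A = A} {e} {u} {v} b (hit before after refl p d f _) with scan (e ∷ []) p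
... | inj₁ p′ = p′
... | inj₂ (hit Q R refl q d′ f′ r) with faulty-same {e = e} f f′
      | Best-drop Q (subst (Best A u v) (++-assoc Q _ _) b) q | Path._∷_ d′ (Path-⊑ (∖-⊑ (e ∷ [])) r)
...   | inj₁ (refl , refl) | b′ | c = contradiction (Best-loopless (_ ∷ R) b′ c) (λ ())
...   | inj₂ (refl , refl) | b′ | c =
  contradiction (Best-loopless ((_ ∷ R) ∷ʳ _) (subst (Best A _ v) (≡-sym (∷ʳ-++ (_ ∷ R) _ _)) b′) (Path-++ c (d ∷ []))) (λ ())

-- Weights depend on direction, so each half is optimal when read away from its own terminal `s` or
-- `t`. Optimality refers to `A`, before the last fault, and survival to `A′`.
record Restored {n} (A A′ : Fin n → Fin n → Bool) (s t : Fin n) (ℓ : ℕ) : Set where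
  constructor restored
  field
    {mid}  : Fin n
    P Q    : List (Fin n)
    best-P : Best A s mid P
    best-Q : Best A t mid Q
    path-P : Path A′ s P mid
    path-Q : Path A′ t Q mid
    total  : length P + length Q ≡ ℓ

-- Add the four inequalities: `uv` and `vu` together weigh as much as `xy` and `yx`, everything else
-- cancels, and the strict inequality remains.
exchange : ∀ {n} {su vy tv ux p p₂ : Vec ℕ (suc (n * n))} {u v x y : Fin n} →
  su ⊕ (edgeWeight u v ⊕ vy) ≺ p ⊕ edgeWeight x y →
  tv ⊕ (edgeWeight v u ⊕ ux) ≼ p₂ ⊕ edgeWeight y x →
  p ≼ su ⊕ ux → p₂ ≼ tv ⊕ vy → ⊥
exchange {n} {su} {vy} {tv} {ux} {p} {p₂} {u} {v} {x} {y} h₁ h₂ h₃ h₄ =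
  ≺-irrefl _ (≺-≼-trans (subst₂ _≺_ left right (⊕-mono-≺-≼ h₁ h₂)) (⊕-mono-≼ (⊕-mono-≼ h₃ h₄) ≼-refl))
  where
  open CMSolver (⊕-commutativeMonoid (suc (n * n))) using (solve; _⊜_) renaming (_⊕_ to _:⊕_)

  left : (su ⊕ (edgeWeight u v ⊕ vy)) ⊕ (tv ⊕ (edgeWeight v u ⊕ ux)) ≡ ((su ⊕ ux) ⊕ (tv ⊕ vy)) ⊕ (edgeWeight x y ⊕ edgeWeight y x)
  left = trans
    (solve 6 (λ su uv vy tv vu ux → (su :⊕ (uv :⊕ vy)) :⊕ (tv :⊕ (vu :⊕ ux)) ⊜ ((su :⊕ ux) :⊕ (tv :⊕ vy)) :⊕ (uv :⊕ vu))
      refl su (edgeWeight u v) vy tv (edgeWeight v u) ux)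
    (cong (((su ⊕ ux) ⊕ (tv ⊕ vy)) ⊕_) (edgeWeight-antisym u v x y))

  right : (p ⊕ edgeWeight x y) ⊕ (p₂ ⊕ edgeWeight y x) ≡ (p ⊕ p₂) ⊕ (edgeWeight x y ⊕ edgeWeight y x)
  right = solve 4 (λ p xy p₂ yx → (p :⊕ xy) :⊕ (p₂ :⊕ yx) ⊜ (p :⊕ p₂) :⊕ (xy :⊕ yx)) refl p (edgeWeight x y) p₂ (edgeWeight y x)

length-∷ʳ : ∀ {A : Set} (xs : List A) {x} → length (xs ∷ʳ x) ≡ suc (length xs)
length-∷ʳ xs = trans (length-++ xs) (+-comm (length xs) 1)

pathWeight-∷ʳ : ∀ {n} {A : Fin n → Fin n → Bool} {u P x} → Path A u P x → ∀ y →
  pathWeight u (P ∷ʳ y) ≡ pathWeight u P ⊕ edgeWeight x y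
pathWeight-∷ʳ {u = u} {P} {x} p y = trans (pathWeight-++ p (y ∷ []))
  (cong (pathWeight u P ⊕_) (CommutativeMonoid.identityʳ (⊕-commutativeMonoid _) _))

module _ {n : ℕ} {A : Fin n → Fin n → Bool} (A-sym : ∀ u v → A u v ≡ A v u) (e : Fin n × Fin n) {s t : Fin n} where

  private
    A′ : Fin n → Fin n → Bool
    A′ = A ∖ (e ∷ [])

    A′⊑A : A′ ⊑ A
    A′⊑A = ∖-⊑ (e ∷ [])

    reverse′ : ∀ {u P v} → Path A′ u P v → ∃ λ Q → Path A′ v Q u × length Q ≡ length P
    reverse′ = Path-reverse (∖-sym A-sym (e ∷ []))

  not-both-hit : ∀ {x y P Z Q R} → Best A s x P → Path A′ s P x → A′ x y ≡ true → Path A′ y Z t →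
    (∀ {R} → Path A′ s R t → length P + suc (length Z) ≤ length R) →
    Best A s y Q → Hit A (e ∷ []) s y Q → Best A t x R → Hit A (e ∷ []) t x R → ⊥
  not-both-hit {x} {y} {P} {Z} {Q} {R} bP p′ xy z shortest bQ hQ@(hit {u} {v} P₁ Q₁ refl p₁ uv f₁ q₁) bR hR@(hit P₂ Q₂ refl p₂ _ f₂ q₂)
    with reverse′ z
  ... | Z⁻ , z⁻ , len-Z⁻ with Best-exists z⁻ | faulty-same {e = e} f₁ f₂ | Hit-before bR hR
  -- `Q` crosses `e` from `u` to `v` and `R` from `v` to `u`. Swapping ends gives the competitors
  -- `P₁ ++ Q₂` of `P` and `P₂ ++ Q₁` of `Y`. The latter must avoid `e`, as `Y` is optimal only in
  -- `A′`.
  ...   | Y , bY | inj₂ (refl , refl) | p₂′ = exchange {u = u} {v} {x} {y} ineq₁ ineq₂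
            (subst (pathWeight s P ≼_) (pathWeight-++ p₁ Q₂) (minimal bP (Path-++ p₁ (Path-⊑ A′⊑A q₂))))
            (subst (pathWeight t Y ≼_) (pathWeight-++ p₂ Q₁) (minimal bY (Path-++ p₂′ q₁)))
    where
    ineq₁ : pathWeight s P₁ ⊕ (edgeWeight u v ⊕ pathWeight v Q₁) ≺ pathWeight s P ⊕ edgeWeight x y
    -- Strict, because equality would make the extension of `P` by `y` optimal too, hence equal to
    -- `Q`, although it avoids `e`.
    ineq₁ with minimal bQ (Path-++ (path bP) (A′⊑A _ _ xy ∷ []))
    ... | inj₁ lt = subst₂ _≺_ (pathWeight-++ p₁ (v ∷ Q₁)) (pathWeight-∷ʳ p′ y) lt
    ... | inj₂ eq = contradiction
            (subst (λ R → Path A′ s R y)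
              (Best-unique (best (Path-++ (path bP) (A′⊑A _ _ xy ∷ [])) (λ r → subst (_≼ _) eq (minimal bQ r))) bQ)
              (Path-++ p′ (xy ∷ [])))
            (Hit⇒¬Path hQ)
    ineq₂ : pathWeight t P₂ ⊕ (edgeWeight v u ⊕ pathWeight u Q₂) ≼ pathWeight t Y ⊕ edgeWeight y x
    ineq₂ = subst₂ _≼_ (pathWeight-++ p₂ (u ∷ Q₂)) (pathWeight-∷ʳ (path bY) x)
      (minimal bR (Path-++ (Path-⊑ A′⊑A (path bY)) (trans (A-sym y x) (A′⊑A _ _ xy) ∷ [])))
  -- In the same direction, `P₁` and the reverse of `P₂` meet at `u` without using `e`. Both `Q` and
  -- `R` spend an edge on `e`, so the joined path is too short.
  ...   | Y , bY | inj₁ (refl , refl) | p₂′ with reverse′ p₂′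
  ...     | P₂⁻ , p₂⁻ , len-P₂⁻ = <-irrefl refl (begin-strict
    length P₁ + length P₂     ≤⟨ +-mono-≤ P₁≤P P₂≤Z ⟩
    length P + length Z       <⟨ +-monoʳ-< (length P) ≤-refl ⟩
    length P + suc (length Z) ≤⟨ shortest (Path-++ (Hit-before bQ hQ) p₂⁻) ⟩
    length (P₁ ++ P₂⁻)        ≡⟨ trans (length-++ P₁) (cong (length P₁ +_) len-P₂⁻) ⟩
    length P₁ + length P₂     ∎)
    where
    open ≤-Reasoning
    P₁≤P : length P₁ ≤ length P
    P₁≤P = ≤-pred (begin
      suc (length P₁)         ≡⟨ length-∷ʳ P₁ ⟨
      length (P₁ ∷ʳ v)        ≤⟨ m≤m+n _ _ ⟩
      length (P₁ ∷ʳ v) + length Q₁ ≡⟨ length-++ (P₁ ∷ʳ v) ⟨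
      length ((P₁ ∷ʳ v) ++ Q₁) ≡⟨ cong length (≡-sym (∷ʳ-++ P₁ _ _)) ⟨
      length (P₁ ++ v ∷ Q₁)   ≤⟨ Best-length bQ (Path-++ (path bP) (A′⊑A _ _ xy ∷ [])) ⟩
      length (P ∷ʳ y)         ≡⟨ length-∷ʳ P ⟩
      suc (length P)          ∎)
    P₂≤Z : length P₂ ≤ length Z
    P₂≤Z = ≤-pred (begin
      suc (length P₂)         ≡⟨ length-∷ʳ P₂ ⟨
      length (P₂ ∷ʳ v)        ≤⟨ m≤m+n _ _ ⟩
      length (P₂ ∷ʳ v) + length Q₂ ≡⟨ length-++ (P₂ ∷ʳ v) ⟨
      length ((P₂ ∷ʳ v) ++ Q₂) ≡⟨ cong length (≡-sym (∷ʳ-++ P₂ _ _)) ⟨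
      length (P₂ ++ v ∷ Q₂)   ≤⟨ Best-length bR (Path-++ (Path-⊑ A′⊑A z⁻) (trans (A-sym y x) (A′⊑A _ _ xy) ∷ [])) ⟩
      length (Z⁻ ∷ʳ x)        ≡⟨ length-∷ʳ Z⁻ ⟩
      suc (length Z⁻)         ≡⟨ cong suc len-Z⁻ ⟩
      suc (length Z)          ∎)

  -- Induction along the shortest path, with the invariant that the optimal path to the current `x`
  -- survives. If this fails at the next vertex `y`, then `not-both-hit` makes `x` the meeting
  -- vertex; if `t` is reached, the second half is empty.
  restore-along : ∀ {x P Z} → Best A s x P → Path A′ s P x → Path A′ x Z t →
    (∀ {R} → Path A′ s R t → length P + length Z ≤ length R) → Restored A A′ s t (length P + length Z)
  restore-along {P = P} bP p′ [] shortest = restored P [] bP Best-[] p′ [] refl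
  restore-along {x} {P} {y ∷ Z} bP p′ (xy ∷ z) shortest with Best-exists {A = A} (Path-++ (path bP) (A′⊑A _ _ xy ∷ []))
  ... | Q , bQ with scan (e ∷ []) (path bQ)
  ...   | inj₁ q′ = subst (Restored A A′ s t) len (restore-along bQ q′ z (λ {R} r → subst (_≤ length R) (≡-sym len) (shortest r)))
    where
    Q≤ : length Q ≤ suc (length P)
    Q≤ = subst (length Q ≤_) (length-∷ʳ P) (Best-length bQ (Path-++ (path bP) (A′⊑A _ _ xy ∷ [])))
    len : length Q + length Z ≡ length P + suc (length Z)
    len = ≤-antisym
      (≤-trans (+-monoˡ-≤ (length Z) Q≤) (≤-reflexive (≡-sym (+-suc (length P) (length Z)))))
      (subst (_ ≤_) (length-++ Q) (shortest (Path-++ q′ z)))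
  ...   | inj₂ hQ with reverse′ (xy ∷ z)
  ...     | Z⁻ , z⁻ , len-Z⁻ with Best-exists {A = A} (Path-⊑ A′⊑A z⁻)
  ...       | R , bR with scan (e ∷ []) (path bR)
  ...         | inj₂ hR = ⊥-elim (not-both-hit bP p′ xy z shortest bQ hQ bR hR)
  ...         | inj₁ r′ = restored P R bP bR p′ r′ (≤-antisym
    (+-monoʳ-≤ (length P) (subst (length R ≤_) len-Z⁻ (Best-length bR (Path-⊑ A′⊑A z⁻)))) P+Z≤P+R)
    where
    P+Z≤P+R : length P + suc (length Z) ≤ length P + length R
    P+Z≤P+R with reverse′ r′
    ... | R⁻ , r⁻ , len-R⁻ = subst (_ ≤_) (trans (length-++ P) (cong (length P +_) len-R⁻)) (shortest (Path-++ p′ r⁻))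

  restore : ∀ {Z} → Path A′ s Z t → (∀ {R} → Path A′ s R t → length Z ≤ length R) → Restored A A′ s t (length Z)
  restore z shortest = restore-along Best-[] [] z shortest

-- Counting and hitting sets

-- A pigeonhole count. The code of the first element is deleted from the list; no other element
-- loses its code, because a code determines its element.
length-≤-codes : ∀ {A B : Set} {R : A → B → Set} → (∀ {x y c} → R x c → R y c → x ≡ y) →
  ∀ {xs} (cs : List B) → Unique xs → All (λ x → ∃ λ c → c ∈ cs × R x c) xs → length xs ≤ length cs
length-≤-codes inj cs [] [] = z≤n
length-≤-codes {R = R} inj {x ∷ xs} cs (x≢ ∷ uniq) ((c , c∈ , r) ∷ rs) with ∈-∃++ c∈
... | cs₁ , cs₂ , refl = subst (suc (length xs) ≤_) len
  (s≤s (length-≤-codes inj (cs₁ ++ cs₂) uniq (All.zipWith avoid-c (x≢ , rs))))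
  where
  len : suc (length (cs₁ ++ cs₂)) ≡ length (cs₁ ++ c ∷ cs₂)
  len = trans (cong suc (length-++ cs₁)) (trans (≡-sym (+-suc (length cs₁) (length cs₂))) (≡-sym (length-++ cs₁)))
  avoid-c : ∀ {y} → x ≢ y × (∃ λ c′ → c′ ∈ cs₁ ++ c ∷ cs₂ × R y c′) → ∃ λ c′ → c′ ∈ cs₁ ++ cs₂ × R y c′
  avoid-c (x≢y , c′ , c′∈ , r′) with ∈-++⁻ cs₁ c′∈
  ... | inj₁ ∈₁         = c′ , ∈-++⁺ˡ ∈₁ , r′
  ... | inj₂ (here refl) = contradiction (inj r r′) x≢y
  ... | inj₂ (there ∈₂) = c′ , ∈-++⁺ʳ cs₁ ∈₂ , r′

length-filterᵇ : ∀ {A : Set} (p : A → Bool) xs → length (filterᵇ p xs) ≡ countList p xs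
length-filterᵇ p [] = refl
length-filterᵇ p (x ∷ xs) with p x
... | true  = cong suc (length-filterᵇ p xs)
... | false = length-filterᵇ p xs

sumList-cong : ∀ {A : Set} {f g : A → ℕ} → (∀ x → f x ≡ g x) → ∀ xs → sumList f xs ≡ sumList g xs
sumList-cong eq []       = refl
sumList-cong eq (x ∷ xs) = cong₂ _+_ (eq x) (sumList-cong eq xs)

sumList-+ : ∀ {A : Set} (f g : A → ℕ) xs → sumList (λ x → f x + g x) xs ≡ sumList f xs + sumList g xs
sumList-+ f g []       = refl
sumList-+ f g (x ∷ xs) = trans (cong (f x + g x +_) (sumList-+ f g xs)) (+-interchange (f x) (g x) _ _)

sumList-0 : ∀ {A : Set} (xs : List A) → sumList (λ _ → 0) xs ≡ 0
sumList-0 []       = refl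
sumList-0 (_ ∷ xs) = sumList-0 xs

sumList-swap : ∀ {A B : Set} (g : A → B → ℕ) xs ys →
  sumList (λ x → sumList (g x) ys) xs ≡ sumList (λ y → sumList (λ x → g x y) xs) ys
sumList-swap g []       ys = ≡-sym (sumList-0 ys)
sumList-swap g (x ∷ xs) ys = trans (cong (sumList (g x) ys +_) (sumList-swap g xs ys))
  (≡-sym (sumList-+ (g x) (λ y → sumList (λ x → g x y) xs) ys))

sumList-mono : ∀ {A : Set} {f g : A → ℕ} → (∀ x → f x ≤ g x) → ∀ xs → sumList f xs ≤ sumList g xs
sumList-mono f≤g []       = z≤n
sumList-mono f≤g (x ∷ xs) = +-mono-≤ (f≤g x) (sumList-mono f≤g xs)

countList-sum : ∀ {A : Set} (p : A → Bool) xs → countList p xs ≡ sumList (λ x → if p x then 1 else 0) xs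
countList-sum p []       = refl
countList-sum p (x ∷ xs) = cong ((if p x then 1 else 0) +_) (countList-sum p xs)

countList-swap : ∀ {A B : Set} (p : A → B → Bool) xs ys →
  sumList (λ x → countList (p x) ys) xs ≡ sumList (λ y → countList (λ x → p x y) xs) ys
countList-swap p xs ys = trans (sumList-cong (λ x → countList-sum (p x) ys) xs)
  (trans (sumList-swap (λ x y → if p x y then 1 else 0) xs ys)
    (≡-sym (sumList-cong (λ y → countList-sum (λ x → p x y) xs) ys)))

countList-∨ : ∀ {A : Set} (p q : A → Bool) xs →
  countList (λ x → p x ∨ q x) xs ≡ countList p xs + countList q (filterᵇ (not ∘ p) xs)
countList-∨ p q [] = refl
countList-∨ p q (x ∷ xs) with p x
... | true  = cong suc (countList-∨ p q xs)
... | false = trans (cong ((if q x then 1 else 0) +_) (countList-∨ p q xs))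
                (+-left-comm (if q x then 1 else 0) (countList p xs) _)

countList-¬∨ : ∀ {A : Set} (p q : A → Bool) xs →
  countList (λ x → not (p x ∨ q x)) xs ≡ countList (not ∘ q) (filterᵇ (not ∘ p) xs)
countList-¬∨ p q [] = refl
countList-¬∨ p q (x ∷ xs) with p x
... | true  = countList-¬∨ p q xs
... | false = cong ((if not (q x) then 1 else 0) +_) (countList-¬∨ p q xs)

countList-true : ∀ {A : Set} (xs : List A) → countList (λ _ → true) xs ≡ length xs
countList-true []       = refl
countList-true (_ ∷ xs) = cong suc (countList-true xs)

countList-not : ∀ {A : Set} (p : A → Bool) xs → countList p xs + countList (not ∘ p) xs ≡ length xs
countList-not p [] = refl
countList-not p (x ∷ xs) with p x
... | true  = cong suc (countList-not p xs)
... | false = trans (+-suc _ _) (cong suc (countList-not p xs))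

max-average : ∀ {A : Set} (c : A → ℕ) → A → ∀ xs → ∃ λ r → sumList c xs ≤ length xs * c r
max-average c r₀ []       = r₀ , z≤n
max-average c r₀ (x ∷ xs) with max-average c r₀ xs
... | r , avg with ≤-total (c x) (c r)
...   | inj₁ x≤r = r , +-mono-≤ x≤r avg
...   | inj₂ r≤x = x , +-monoʳ-≤ (c x) (≤-trans avg (*-monoʳ-≤ (length xs) r≤x))

sumList-≥ : ∀ {A : Set} {d} {c : A → ℕ} {xs} → All (λ x → d ≤ c x) xs → d * length xs ≤ sumList c xs
sumList-≥ {d = d} [] = ≤-reflexive (*-zeroʳ d)
sumList-≥ {d = d} {c} {x ∷ xs} (p ∷ ps) = subst (_≤ c x + sumList c xs) (≡-sym (*-suc d (length xs))) (+-mono-≤ p (sumList-≥ ps))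

length-allFin : ∀ n → length (allFin n) ≡ n
length-allFin n = length-tabulate id

-- Double counting of incidences between items and vertices, then averaging over the vertices.
-- Positivity rules out an empty vertex set.
∃-popular : ∀ {I : Set} {n d} (h : I → Fin n → Bool) {Y : List I} → 0 < d * length Y →
  All (λ i → d ≤ countList (h i) (allFin n)) Y → ∃ λ r → d * length Y ≤ n * countList (λ i → h i r) Y
∃-popular {n = zero} {d} h {Y} pos all = contradiction
  (≤-trans pos (≤-trans (sumList-≥ all) (≤-reflexive (sumList-0 Y)))) (λ ())
∃-popular {n = suc n} {d} h {Y} pos all with max-average (λ r → countList (λ i → h i r) Y) Fin.zero (allFin (suc n))
... | r , avg = r , (begin
  d * length Y                                              ≤⟨ sumList-≥ all ⟩
  sumList (λ i → countList (h i) (allFin (suc n))) Y        ≡⟨ countList-swap h Y (allFin (suc n)) ⟩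
  sumList (λ r → countList (λ i → h i r) Y) (allFin (suc n)) ≤⟨ avg ⟩
  length (allFin (suc n)) * countList (λ i → h i r) Y       ≡⟨ cong (_* countList (λ i → h i r) Y) (length-allFin (suc n)) ⟩
  suc n * countList (λ i → h i r) Y                         ∎)
  where open ≤-Reasoning

All-filterᵇ : ∀ {A : Set} {P : A → Set} (p : A → Bool) {xs} → All P xs → All P (filterᵇ p xs)
All-filterᵇ p [] = []
All-filterᵇ p {x ∷ xs} (q ∷ qs) with p x
... | true  = q ∷ All-filterᵇ p qs
... | false = All-filterᵇ p qs

-- While more than x / 2 items are not hit, the most popular vertex hits d x / (2 n) of them.
-- Stopping there, rather than hitting all items, saves a logarithmic factor.
greedy-hitting : ∀ {I : Set} {n d} → 0 < d → (h : I → Fin n → Bool) (x fuel : ℕ) (Y : List I) → length Y ≤ fuel →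
  All (λ i → d ≤ countList (h i) (allFin n)) Y →
  ∃ λ R → length R * (d * x) ≤ 2 * n * countList (λ i → any (h i) R) Y × 2 * countList (λ i → not (any (h i) R)) Y ≤ x
greedy-hitting {n = n} {d} 0<d h x fuel Y Y≤fuel all with 2 * length Y ≤? x
... | yes small = [] , z≤n , subst (λ k → 2 * k ≤ x) (≡-sym (countList-true Y)) small
greedy-hitting {n = n} {d} 0<d h x zero [] Y≤fuel all | no big = contradiction z≤n big
greedy-hitting {n = n} {d} 0<d h x (suc fuel) Y Y≤fuel all | no big
  with ∃-popular h (*-mono-≤ 0<d (0<length Y big)) all
  where
  0<length : ∀ Y → ¬ 2 * length Y ≤ x → 0 < length Y
  0<length []      big = contradiction z≤n big
  0<length (_ ∷ _) big = s≤s z≤n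
... | r , popular with greedy-hitting 0<d h x fuel (filterᵇ (λ i → not (h i r)) Y) Y′≤fuel (All-filterᵇ _ all)
  where
  0<hits : 0 < countList (λ i → h i r) Y
  0<hits with countList (λ i → h i r) Y
  ... | suc _ = s≤s z≤n
  ... | zero = contradiction (begin
    2 * length Y       ≤⟨ *-monoʳ-≤ 2 (m≤n*m′ (length Y) 0<d) ⟩
    2 * (d * length Y) ≤⟨ *-monoʳ-≤ 2 popular ⟩
    2 * (n * 0)        ≡⟨ cong (2 *_) (*-zeroʳ n) ⟩
    0                  ≤⟨ z≤n ⟩
    x                  ∎) big
    where
    open ≤-Reasoning
    m≤n*m′ : ∀ m {n} → 0 < n → m ≤ n * m
    m≤n*m′ m {suc n} _ = m≤m+n m (n * m)
  Y′≤fuel : length (filterᵇ (λ i → not (h i r)) Y) ≤ fuel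
  Y′≤fuel = ≤-pred (begin
    1 + length (filterᵇ (λ i → not (h i r)) Y)                                  ≡⟨ cong suc (length-filterᵇ _ Y) ⟩
    1 + countList (λ i → not (h i r)) Y                                         ≤⟨ +-monoˡ-≤ _ 0<hits ⟩
    countList (λ i → h i r) Y + countList (λ i → not (h i r)) Y                 ≡⟨ countList-not (λ i → h i r) Y ⟩
    length Y                                                                    ≤⟨ Y≤fuel ⟩
    suc fuel                                                                    ∎)
    where open ≤-Reasoning
... | R , cost , rest = r ∷ R
  , (begin
      d * x + length R * (d * x)                            ≤⟨ +-mono-≤ step cost ⟩
      2 * n * hits + 2 * n * countList (λ i → any (h i) R) Y′ ≡⟨ *-distribˡ-+ (2 * n) hits _ ⟨
      2 * n * (hits + countList (λ i → any (h i) R) Y′)     ≡⟨ cong (2 * n *_) (countList-∨ (λ i → h i r) _ Y) ⟨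
      2 * n * countList (λ i → any (h i) (r ∷ R)) Y         ∎)
  , subst (λ k → 2 * k ≤ x) (≡-sym (countList-¬∨ (λ i → h i r) _ Y)) rest
  where
  open ≤-Reasoning
  hits = countList (λ i → h i r) Y
  Y′ = filterᵇ (λ i → not (h i r)) Y
  -- More than `x` / 2 items remain, so the price `d * x` of one vertex is covered by charging 2 `n`
  -- to each item that it newly hits.
  step : d * x ≤ 2 * n * hits
  step = begin
    d * x              ≤⟨ *-monoʳ-≤ d (<⇒≤ (≰⇒> big)) ⟩
    d * (2 * length Y) ≡⟨ *-left-comm d 2 (length Y) ⟩
    2 * (d * length Y) ≤⟨ *-monoʳ-≤ 2 popular ⟩
    2 * (n * hits)     ≡⟨ *-assoc 2 n hits ⟨
    2 * n * hits       ∎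

-- Codes for sequences of distances

insertAt : ∀ {A : Set} → ℕ → A → List A → List A
insertAt i x xs = take i xs ++ x ∷ drop i xs

insertAt-length : ∀ {A : Set} (xs : List A) x ys → insertAt (length xs) x (xs ++ ys) ≡ xs ++ x ∷ ys
insertAt-length []       x ys = refl
insertAt-length (z ∷ xs) x ys = cong (z ∷_) (insertAt-length xs x ys)

-- The sequences of length at most f whose entries can be matched to distinct thresholds
-- among D ^ 2 ^ 0, ..., D ^ 2 ^ (f - 1), each entry lying below its threshold.
codes : ℕ → ℕ → List (List ℕ)
codes D zero    = [] ∷ []
codes D (suc f) = codes D f ++
  cartesianProductWith (uncurry insertAt) (cartesianProduct (upTo (suc f)) (upTo (D ^ (2 ^ f)))) (codes D f)

length-cartesianProductWith : ∀ {A B C : Set} (f : A → B → C) xs ys →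
  length (cartesianProductWith f xs ys) ≡ length xs * length ys
length-cartesianProductWith f []       ys = refl
length-cartesianProductWith f (x ∷ xs) ys = trans (length-++ (map (f x) ys))
  (cong₂ _+_ (length-map (f x) ys) (length-cartesianProductWith f xs ys))

^-double : ∀ D f → D ^ (2 ^ suc f) ≡ D ^ (2 ^ f) * D ^ (2 ^ f)
^-double D f = trans (cong (λ k → D ^ (2 ^ f + k)) (+-identityʳ (2 ^ f))) (^-distribˡ-+-* D (2 ^ f) (2 ^ f))

0<^ : ∀ {D} → 0 < D → ∀ k → 0 < D ^ k
0<^ {suc D} _ k = m^n>0 (suc D) k

-- The thresholds multiply to `D` to the power 2^f - 1; the extra factor `D` on the left avoids this
-- subtraction. At each level, the `suc f` insertion positions and the option of no insertion give
-- the next factor of the factorial.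
length-codes : ∀ {D} → 0 < D → ∀ f → length (codes D f) * D ≤ suc f ! * D ^ (2 ^ f)
length-codes {D} 0<D zero    = ≤-reflexive (cong (1 *_) (≡-sym (*-identityʳ D)))
length-codes {D} 0<D (suc f) = begin
  length (codes D (suc f)) * D                   ≡⟨ cong (_* D) len ⟩
  (L + suc f * t * L) * D                        ≡⟨ regroup (suc f) t L D ⟩
  (1 + suc f * t) * (L * D)                      ≤⟨ *-mono-≤ (+-monoˡ-≤ (suc f * t) (0<^ 0<D (2 ^ f))) (length-codes 0<D f) ⟩
  (suc (suc f) * t) * (suc f ! * t)              ≡⟨ *-interchange (suc (suc f)) t (suc f !) t ⟩
  (suc (suc f) * suc f !) * (t * t)              ≡⟨ cong (suc (suc f) ! *_) (^-double D f) ⟨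
  suc (suc f) ! * D ^ (2 ^ suc f)                ∎
  where
  open ≤-Reasoning
  t = D ^ (2 ^ f)
  L = length (codes D f)
  len : length (codes D (suc f)) ≡ L + suc f * t * L
  len = trans (length-++ (codes D f)) (cong (L +_)
    (trans (length-cartesianProductWith _ (cartesianProduct (upTo (suc f)) (upTo t)) (codes D f))
      (cong (_* L) (trans (length-cartesianProductWith _,_ (upTo (suc f)) (upTo t))
        (cong₂ _*_ (length-upTo (suc f)) (length-upTo t))))))
  regroup : ∀ a t l d → (l + a * t * l) * d ≡ (1 + a * t) * (l * d)
  regroup = solve-∀

max-split : ∀ ps → 0 < length ps → ∃ λ l → ∃₂ λ p r → ps ≡ l ++ p ∷ r × All (_≤ p) (l ++ r)
max-split (p ∷ [])     _ = [] , p , [] , refl , []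
max-split (q ∷ ps@(_ ∷ _)) _ with max-split ps (s≤s z≤n)
... | l , p , r , eq , ≤p with ≤-total q p
...   | inj₁ q≤p = q ∷ l , p , r , cong (q ∷_) eq , q≤p ∷ ≤p
...   | inj₂ p≤q = [] , q , ps , refl , subst (All (_≤ q)) (≡-sym eq)
        (All.++⁺ (All.map (λ x≤p → ≤-trans x≤p p≤q) (All.++⁻ˡ l ≤p))
          (p≤q ∷ All.map (λ x≤p → ≤-trans x≤p p≤q) (All.++⁻ʳ l ≤p)))

-- When all entries lie below the top threshold, the largest of them is matched to it; if the rest has
-- an entry above a lower threshold, so does the largest, hence removing it does not affect the count.
dichotomy : ∀ D f ps → length ps ≤ f → ps ∈ codes D f ⊎
  (∃ λ g → g < f × length (filter (_<? D ^ (2 ^ g)) ps) ≤ g × Any (D ^ (2 ^ g) ≤_) ps)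
dichotomy D zero    []       _   = inj₁ (here refl)
dichotomy D (suc f) ps ps≤ with length ps ≤? f
... | yes ps≤f with dichotomy D f ps ps≤f
...   | inj₁ ∈codes = inj₁ (∈-++⁺ˡ ∈codes)
...   | inj₂ (g , g<f , rest) = inj₂ (g , m<n⇒m<1+n g<f , rest)
dichotomy D (suc f) ps ps≤ | no ps≰f with all? (_<? D ^ (2 ^ f)) ps
-- Some entry reaches the top threshold, so at most `f` of the at most `suc f` entries lie below it.
... | no ¬all = inj₂ (f , ≤-refl , ≤-pred (≤-trans (filter-notAll (_<? D ^ (2 ^ f)) ps big) ps≤) , Any.map ≮⇒≥ big)
  where
  big : Any (λ p → ¬ p < D ^ (2 ^ f)) ps
  big = All.¬All⇒Any¬ (_<? D ^ (2 ^ f)) ps ¬all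
... | yes all with max-split ps (≤-trans (s≤s z≤n) (≰⇒> ps≰f))
...   | l , p , r , refl , ≤p with dichotomy D f (l ++ r) (≤-pred (subst (_≤ suc f) len ps≤))
  where
  len : length (l ++ p ∷ r) ≡ suc (length (l ++ r))
  len = trans (length-++ l) (trans (+-suc (length l) (length r)) (cong suc (≡-sym (length-++ l))))
...     | inj₁ ∈codes = inj₁ (∈-++⁺ʳ (codes D f) (subst (_∈ cartesianProductWith _ (cartesianProduct (upTo (suc f)) (upTo (D ^ (2 ^ f)))) (codes D f)) (insertAt-length l p r)
  (∈-cartesianProductWith⁺ (uncurry insertAt)
    (∈-cartesianProduct⁺ (∈-upTo⁺ l<) (∈-upTo⁺ (All.lookup all (∈-insert l)))) ∈codes)))
  where
  l< : length l < suc f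
  l< = ≤-trans (subst (suc (length l) ≤_) (≡-sym (trans (length-++ l) (+-suc (length l) (length r)))) (s≤s (m≤m+n (length l) (length r)))) ps≤
...     | inj₂ (g , g<f , few , above) = inj₂ (g , m<n⇒m<1+n g<f , subst (_≤ g) (≡-sym len) few , lose (∈-insert l) g≤p)
  where
  g≤p : D ^ (2 ^ g) ≤ p
  g≤p with find above
  ... | q , q∈ , ≤q = ≤-trans ≤q (All.lookup ≤p q∈)
  len : length (filter (_<? D ^ (2 ^ g)) (l ++ p ∷ r)) ≡ length (filter (_<? D ^ (2 ^ g)) (l ++ r))
  len = cong length (trans (filter-++ (_<? D ^ (2 ^ g)) l (p ∷ r))
    (trans (cong (filter (_<? D ^ (2 ^ g)) l ++_) (filter-reject (_<? D ^ (2 ^ g)) (≤⇒≯ g≤p)))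
      (≡-sym (filter-++ (_<? D ^ (2 ^ g)) l r))))

-- Edges entering a fixed target

++-cancel-length : ∀ {A : Set} (xs xs′ : List A) {ys ys′} → xs ++ ys ≡ xs′ ++ ys′ → length ys ≡ length ys′ → xs ≡ xs′ × ys ≡ ys′
++-cancel-length []       []         eq len = refl , eq
++-cancel-length []       (x ∷ xs′) {ys} {ys′} eq len = contradiction (trans (≡-sym len) (trans (cong length eq) (cong suc (length-++ xs′)))) (m≢1+n+m _)
++-cancel-length (x ∷ xs) [] {ys} {ys′} eq len = contradiction (trans len (trans (cong length (≡-sym eq)) (cong suc (length-++ xs)))) (m≢1+n+m _)
++-cancel-length (x ∷ xs) (x′ ∷ xs′) eq len with ∷-injective eq
... | refl , eq′ with ++-cancel-length xs xs′ eq′ len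
...   | refl , refl = refl , refl

⊆F-intro : ∀ {n} {F K : FaultSet n} → (∀ {e} → e ∈ F → ∃ λ e′ → e′ ∈ K × (∀ {u v} → SameEdge e u v → SameEdge e′ u v)) → F ⊆F K
⊆F-intro {F = F} cover u v f with isFaulty⁻ F f
... | e , e∈F , same with cover e∈F
...   | e′ , e′∈K , same→ = isFaulty⁺ e′∈K (same→ same)

∖-∈-⊑ : ∀ {n} {A : Fin n → Fin n → Bool} F K → (∀ {e} → e ∈ F → e ∈ K) → A ∖ K ⊑ A ∖ F
∖-∈-⊑ F K F⊆K = ∖-antitone F K (⊆F-intro (λ e∈F → _ , F⊆K e∈F , id))

∖∖-⊑ : ∀ {n} {A : Fin n → Fin n → Bool} F K → A ∖ F ∖ K ⊑ A ∖ K
∖∖-⊑ {A = A} F K u v eq with ∖⁻ (A ∖ F) K eq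
... | a , k = ∖⁺ A K (proj₁ (∖⁻ A F a)) k

∖∖-⊑-++ : ∀ {n} {A : Fin n → Fin n → Bool} F K → A ∖ F ∖ K ⊑ A ∖ (K ++ F)
∖∖-⊑-++ {A = A} F K u v eq with ∖⁻ (A ∖ F) K eq
... | a , k with ∖⁻ A F a
...   | a′ , f = ∖⁺ A (K ++ F) a′ (¬-not λ kf →
        let e , e∈ , same = isFaulty⁻ (K ++ F) kf
        in [ (λ e∈K → contradiction (trans (≡-sym k) (isFaulty⁺ e∈K same)) (λ ()))
           , (λ e∈F → contradiction (trans (≡-sym f) (isFaulty⁺ e∈F same)) (λ ())) ]′ (∈-++⁻ K e∈))

++-⊑-∖∖ : ∀ {n} {A : Fin n → Fin n → Bool} F K → A ∖ (K ++ F) ⊑ A ∖ F ∖ K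
++-⊑-∖∖ {A = A} F K u v eq = ∖⁺ (A ∖ F) K (∖-∈-⊑ {A = A} F (K ++ F) (∈-++⁺ʳ K) u v eq)
  (proj₂ (∖⁻ A K (∖-∈-⊑ {A = A} K (K ++ F) ∈-++⁺ˡ u v eq)))

-- Chains of faults

Entry : ℕ → Set
Entry n = (Fin n × Fin n) × ℕ

faults : ∀ {n} → List (Entry n) → FaultSet n
faults = map proj₁

-- Each fault lies on the optimal path that avoids the earlier ones (those to its right in the list)
-- and is recorded with its distance to the target.
data Chain {n} (A : Fin n → Fin n → Bool) (s b : Fin n) : List (Entry n) → Set where
  []   : Chain A s b []
  step : ∀ {L P Q x y} → Chain A s b L → Best (A ∖ faults L) s b (P ++ y ∷ Q) → Path (A ∖ faults L) s P x →
         Chain A s b (((x , y) , length Q) ∷ L)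

-- Induction from the oldest fault: the earlier faults fix the optimal path, and on it the recorded
-- distance to `b` locates the next fault.
Chain-functional : ∀ {n} {A : Fin n → Fin n → Bool} {s b L L′} → Chain A s b L → Chain A s b L′ →
  map proj₂ L ≡ map proj₂ L′ → L ≡ L′
Chain-functional [] [] eq = refl
Chain-functional (step {P = P} c b p) (step {P = P′} c′ b′ p′) eq with ∷-injective eq
... | len , eqs with Chain-functional c c′ eqs
...   | refl with ++-cancel-length P P′ (Best-unique b b′) (cong suc len)
...     | refl , refl with Path-end-unique p p′
...       | refl = refl

-- When the fault was recorded, its ends were at distances `p + 1` and `p` from `b`, and the source
-- was no nearer than `p + 1`. Later faults only increase distances.
Chain-distance : ∀ {n} {A : Fin n → Fin n → Bool} {s b L e p} → Chain A s b L → (e , p) ∈ L →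
  (∀ {Q} → Path (A ∖ faults L) s Q b → p < length Q) ×
  (∀ {x y Q} → SameEdge e x y → Path (A ∖ faults L) y Q b → p ≤ length Q)
Chain-distance {A = A} {s} {b} (step {L} {P} {Q} {x} {y} c bP q) (here refl) = from-s , from-e
  where
  weaken : A ∖ ((x , y) ∷ faults L) ⊑ A ∖ faults L
  weaken = ∖-∈-⊑ (faults L) ((x , y) ∷ faults L) there
  bx : Best (A ∖ faults L) x b (y ∷ Q)
  bx = Best-drop P bP q
  from-s : ∀ {R} → Path (A ∖ ((x , y) ∷ faults L)) s R b → length Q < length R
  from-s r = ≤-trans (m≤n+m (suc (length Q)) (length P)) (subst (_≤ _) (length-++ P) (Best-length bP (Path-⊑ weaken r)))
  from-e : ∀ {x′ y′ R} → SameEdge (x , y) x′ y′ → Path (A ∖ ((x , y) ∷ faults L)) y′ R b → length Q ≤ length R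
  from-e (inj₁ (refl , refl)) r = Best-length (Best-tail bx) (Path-⊑ weaken r)
  from-e (inj₂ (refl , refl)) r = <⇒≤ (Best-length bx (Path-⊑ weaken r))
Chain-distance {A = A} (step {L} {x = x} {y} c _ _) (there e∈) with Chain-distance c e∈
... | from-s , from-e = from-s ∘ Path-⊑ weaken , λ same → from-e same ∘ Path-⊑ weaken
  where
  weaken : A ∖ ((x , y) ∷ faults L) ⊑ A ∖ faults L
  weaken = ∖-∈-⊑ (faults L) ((x , y) ∷ faults L) there

-- `K` holds the faults not yet chained. If the optimal path that avoids the chain meets one of
-- them, that fault joins the chain; otherwise this path is `R` by uniqueness. The bound `k` makes
-- the recursion structural.
Chain-exists : ∀ {n} {A : Fin n → Fin n → Bool} {s b R} k K {L} → length K ≤ k → Chain A s b L →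
  Best (A ∖ (K ++ faults L)) s b R →
  ∃ λ L′ → Chain A s b L′ × length L′ ≤ length K + length L × Best (A ∖ faults L′) s b R
Chain-exists {A = A} {s} {b} {R} k K {L} K≤k c bR
  with Best-exists (Path-⊑ (∖-∈-⊑ (faults L) (K ++ faults L) (∈-++⁺ʳ K)) (path bR))
... | P , bP with scan K (path bP)
...   | inj₁ p′ = L , c , m≤n+m (length L) (length K) ,
        subst (Best _ s b) (Best-unique (Best-⊑ weaken bP (Path-⊑ (∖∖-⊑-++ (faults L) K) p′)) bR) bP
  where
  weaken : A ∖ (K ++ faults L) ⊑ A ∖ faults L
  weaken = ∖-∈-⊑ (faults L) (K ++ faults L) (∈-++⁺ʳ K)
...   | inj₂ (hit {x} {y} before after refl p _ f _) with isFaulty⁻ K f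
...     | e , e∈K , same with ∈-∃++ e∈K
Chain-exists {A = A} {s} {b} {R} zero .(K₁ ++ e ∷ K₂) {L} K≤k c bR | P , bP | inj₂ _ | e , _ , _ | K₁ , K₂ , refl =
  contradiction (≤-trans (subst (1 ≤_) (≡-sym (trans (length-++ K₁) (+-suc (length K₁) (length K₂)))) (s≤s z≤n)) K≤k) (λ ())
Chain-exists {A = A} {s} {b} {R} (suc k) .(K₁ ++ e ∷ K₂) {L} K≤k c bR | P , bP | inj₂ (hit {x} {y} before after refl p _ f _) | e , _ , same | K₁ , K₂ , refl
  with Chain-exists k (K₁ ++ K₂) (≤-pred (subst (_≤ suc k) len K≤k)) (step c bP p)
    (Best-⊑ fewer bR (Path-⊑ more (path bR)))
  where
  len : length (K₁ ++ e ∷ K₂) ≡ suc (length (K₁ ++ K₂))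
  len = trans (length-++ K₁) (trans (+-suc (length K₁) (length K₂)) (cong suc (≡-sym (length-++ K₁))))

  -- The moved fault is recorded in the direction of traversal, so the two lists agree only as sets
  -- of undirected edges.
  old new : FaultSet _
  old = (K₁ ++ e ∷ K₂) ++ faults L
  new = (K₁ ++ K₂) ++ (x , y) ∷ faults L

  xy→e : ∀ {u v} → SameEdge (x , y) u v → SameEdge e u v
  xy→e (inj₁ (refl , refl)) = same
  xy→e (inj₂ (refl , refl)) = SameEdge-swap same

  e→xy : ∀ {u v} → SameEdge e u v → SameEdge (x , y) u v
  e→xy s with SameEdge-same same s
  ... | inj₁ (refl , refl) = inj₁ (refl , refl)
  ... | inj₂ (refl , refl) = inj₂ (refl , refl)

  old⊆new : old ⊆F new
  old⊆new = ⊆F-intro λ e′∈ → [ fromK , (λ ∈L → _ , ∈-++⁺ʳ (K₁ ++ K₂) (there ∈L) , id) ]′ (∈-++⁻ (K₁ ++ e ∷ K₂) e′∈)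
    where
    fromK : ∀ {e′} → e′ ∈ K₁ ++ e ∷ K₂ → ∃ λ e″ → e″ ∈ new × (∀ {u v} → SameEdge e′ u v → SameEdge e″ u v)
    fromK e′∈ with ∈-++⁻ K₁ e′∈
    ... | inj₁ ∈K₁         = _ , ∈-++⁺ˡ (∈-++⁺ˡ ∈K₁) , id
    ... | inj₂ (here refl) = _ , ∈-insert (K₁ ++ K₂) , e→xy
    ... | inj₂ (there ∈K₂) = _ , ∈-++⁺ˡ (∈-++⁺ʳ K₁ ∈K₂) , id

  new⊆old : new ⊆F old
  new⊆old = ⊆F-intro λ e′∈ → [ fromK , fromL ]′ (∈-++⁻ (K₁ ++ K₂) e′∈)
    where
    fromK : ∀ {e′} → e′ ∈ K₁ ++ K₂ → ∃ λ e″ → e″ ∈ old × (∀ {u v} → SameEdge e′ u v → SameEdge e″ u v)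
    fromK e′∈ with ∈-++⁻ K₁ e′∈
    ... | inj₁ ∈K₁ = _ , ∈-++⁺ˡ (∈-++⁺ˡ ∈K₁) , id
    ... | inj₂ ∈K₂ = _ , ∈-++⁺ˡ (∈-++⁺ʳ K₁ (there ∈K₂)) , id
    fromL : ∀ {e′} → e′ ∈ (x , y) ∷ faults L → ∃ λ e″ → e″ ∈ old × (∀ {u v} → SameEdge e′ u v → SameEdge e″ u v)
    fromL (here refl) = _ , ∈-++⁺ˡ (∈-insert K₁) , xy→e
    fromL (there ∈L)  = _ , ∈-++⁺ʳ (K₁ ++ e ∷ K₂) ∈L , id

  fewer : A ∖ new ⊑ A ∖ old
  fewer = ∖-antitone old new old⊆new
  more : A ∖ old ⊑ A ∖ new
  more = ∖-antitone new old new⊆old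
... | L′ , c′ , L′≤ , bR′ = L′ , c′ , ≤-trans L′≤ (≤-reflexive eq) , bR′
  where
  eq : length (K₁ ++ K₂) + suc (length L) ≡ length (K₁ ++ e ∷ K₂) + length L
  eq = trans (+-suc _ (length L)) (cong (_+ length L)
    (trans (cong suc (length-++ K₁)) (trans (≡-sym (+-suc (length K₁) (length K₂))) (≡-sym (length-++ K₁)))))

-- Arrivals at the target and far faults

Best-take : ∀ {n} {A : Fin n → Fin n → Bool} {u v w} P {Q} → Best A u v (P ++ Q) → Path A u P w → Best A u w P
Best-take P b p with Best-split P b
... | _ , b₁ , _ rewrite Path-end-unique p (path b₁) = b₁

Path-prefix : ∀ {n} {A B : Fin n → Fin n → Bool} {u v w} P {Q} → Path A u (P ++ Q) v → Path B u P w → Path A u P w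
Path-prefix P p q with Path-split P p
... | _ , p₁ , _ rewrite Path-end-unique q p₁ = p₁

record Arrives {n} (A : Fin n → Fin n → Bool) (s a b : Fin n) : Set where
  constructor arrives
  field
    {P}    : List (Fin n)
    best-P : Best A s b (P ∷ʳ b)
    path-P : Path A s P a

ArrivesFT : ∀ {n} → (Fin n → Fin n → Bool) → ℕ → Fin n → Fin n → Fin n → Set
ArrivesFT A f s a b = ∃ λ F → length F ≤ f × Arrives (A ∖ F) s a b

near : ∀ {n} → ℕ → List (Entry n) → List (Entry n)
near t = filter (λ ep → proj₂ ep <? t)

length-near : ∀ {n} t (L : List (Entry n)) → length (near t L) ≡ length (filter (_<? t) (map proj₂ L))
length-near t [] = refl
length-near t ((e , p) ∷ L) with does (p <? t)
... | true  = cong suc (length-near t L)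
... | false = length-near t L

near-⊑ : ∀ {n} {A : Fin n → Fin n → Bool} t L → A ∖ faults L ⊑ A ∖ faults (near t L)
near-⊑ t L = ∖-∈-⊑ (faults (near t L)) (faults L) λ e∈ →
  let _ , ep∈ , eq = ∈-map⁻ proj₁ e∈
  in subst (_∈ faults L) (≡-sym eq) (∈-map⁺ proj₁ (proj₁ (∈-filter⁻ (λ ep → proj₂ ep <? t) ep∈)))

-- The optimal path avoiding only the near faults has at most `t` edges. After its last use of a far
-- fault, at least `t` edges would have to follow by `Chain-distance`; so it uses none and coincides
-- with `Q`.
drop-far : ∀ {n} {A : Fin n → Fin n → Bool} {s b r Q} t {L} → Chain A s b L →
  Best (A ∖ faults L) r b Q → length Q ≤ t → Best (A ∖ faults (near t L)) r b Q
drop-far {A = A} {s} {b} {r} {Q} t {L} c bQ Q≤t with Best-exists (Path-⊑ (near-⊑ t L) (path bQ))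
... | R , bR with scan (faults L) (path bR)
...   | inj₁ r′ = subst (Best _ r b) (Best-unique (Best-⊑ (near-⊑ t L) bR (Path-⊑ (∖∖-⊑ (faults (near t L)) (faults L)) r′)) bQ) bR
...   | inj₂ (hit {x} {y} before after refl _ ok f after-path) with isFaulty⁻ (faults L) f
...     | e , e∈ , same with ∈-map⁻ proj₁ e∈
...       | (.e , p) , ep∈ , refl with p <? t
...         | yes p<t = contradiction
  (trans (≡-sym (proj₂ (∖⁻ A (faults (near t L)) ok)))
    (isFaulty⁺ (∈-map⁺ proj₁ (∈-filter⁺ (λ ep → proj₂ ep <? t) ep∈ p<t)) same)) (λ ())
...         | no p≮t = contradiction (begin-strict
  t                              ≤⟨ ≮⇒≥ p≮t ⟩
  p                              ≤⟨ proj₂ (Chain-distance c ep∈) same (Path-⊑ (∖∖-⊑ (faults (near t L)) (faults L)) after-path) ⟩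
  length after                   <⟨ m≤n+m (suc (length after)) (length before) ⟩
  length before + suc (length after) ≡⟨ length-++ before ⟨
  length (before ++ y ∷ after)   ≤⟨ Best-length bR (Path-⊑ (near-⊑ t L) (path bQ)) ⟩
  length Q                       ≤⟨ Q≤t ⟩
  t                              ∎) (<-irrefl refl)
  where open ≤-Reasoning

-- Any of these vertices can act as the source for the edge `ab`, with only `g` faults, so a small
-- hitting set can replace the original sources.
record Spread {n} (A : Fin n → Fin n → Bool) (t g : ℕ) (a b : Fin n) : Set where
  constructor spread
  field
    source    : Fin t → Fin n
    injective : ∀ {i j} → source i ≡ source j → i ≡ j
    arrival   : ∀ i → ArrivesFT A g (source i) a b

Chain⇒Spread : ∀ {n} {A : Fin n → Fin n → Bool} {s a b L t g} → Chain A s b L → Arrives (A ∖ faults L) s a b →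
  length (near t L) ≤ g → Any (λ ep → t ≤ proj₂ ep) L → Spread A t g a b
Chain⇒Spread {A = A} {s} {a} {b} {L} {t} {g} c (arrives {P} bP p) few far = spread
  (λ i → Suffix.vertex (at i)) (λ {i} {j} eq → toℕ-injective (Suffix-injective (at i) (at j) eq))
  (λ i → faults (near t L) , ≤-trans (≤-reflexive (length-map proj₁ (near t L))) few , arrival (toℕ<n i) (at i))
  where
  t≤P : t ≤ length P
  t≤P with find far
  -- A fault at distance `t` or more forces the path to `b` to have more than `t` edges; the last of
  -- them, `ab`, is not in `P`.
  ... | ep , ep∈ , t≤p = ≤-pred (≤-trans (s≤s t≤p)
    (≤-trans (proj₁ (Chain-distance c ep∈) (path bP)) (≤-reflexive (length-∷ʳ P))))
  at : (i : Fin t) → Suffix (A ∖ faults L) s a P (toℕ i)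
  at i = Best-suffix (Best-take P bP p) (≤-trans (<⇒≤ (toℕ<n i)) t≤P)
  arrival : ∀ {j} → j < t → (x : Suffix (A ∖ faults L) s a P j) → Arrives (A ∖ faults (near t L)) (Suffix.vertex x) a b
  -- The suffix of length `j` becomes one of length `suc j` when extended to `b`, which is still at
  -- most `t`.
  arrival j<t (suffix front back refl len bf bb) = arrives
    (drop-far t c (Best-drop front (subst (Best _ s b) (++-assoc front back (b ∷ [])) bP) (path bf))
      (≤-trans (≤-reflexive (trans (length-∷ʳ back) (cong suc len))) j<t))
    (Path-⊑ (near-⊑ t L) (path bb))

Settled : ∀ {n} → (Fin n → Fin n → Bool) → List (Fin n) → List (List ℕ) → Fin n → Fin n → Set
Settled A S cs b a = ∃ λ c → c ∈ cartesianProduct S cs ×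
  (∃ λ L → Chain A (proj₁ c) b L × map proj₂ L ≡ proj₂ c × Arrives (A ∖ faults L) (proj₁ c) a b)

Reached : ∀ {n} → (Fin n → Fin n → Bool) → List (Fin n) → ℕ → Fin n → Fin n → Set
Reached A S f b a = ∃ λ s → s ∈ S × ArrivesFT A f s a b

-- The fault set is first replaced by a chain with the same optimal path; `dichotomy` then applies
-- to the distances recorded in the chain.
classify : ∀ {n} {A : Fin n → Fin n → Bool} {S f a b} D → Reached A S f b a →
  Settled A S (codes D f) b a ⊎ (∃ λ g → g < f × Spread A (D ^ (2 ^ g)) g a b)
classify {A = A} {f = f} {a} {b} D (s , s∈S , F , F≤f , arrives {P} bP p)
  with Chain-exists (length F) F {[]} ≤-refl [] (subst (λ K → Best (A ∖ K) s b (P ∷ʳ b)) (≡-sym (++-identityʳ F)) bP)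
... | L , c , L≤ , bP′ with dichotomy D f (map proj₂ L) ps≤f
  where
  ps≤f : length (map proj₂ L) ≤ f
  ps≤f = ≤-trans (≤-reflexive (length-map proj₂ L)) (≤-trans L≤ (≤-trans (≤-reflexive (+-identityʳ (length F))) F≤f))
...   | inj₁ ∈codes = inj₁ ((s , map proj₂ L) , ∈-cartesianProduct⁺ s∈S ∈codes , L , c , refl , arrives bP′ (Path-prefix P (path bP′) p))
...   | inj₂ (g , g<f , few , far) = inj₂ (g , g<f , Chain⇒Spread c (arrives bP′ (Path-prefix P (path bP′) p))
        (subst (_≤ g) (≡-sym (length-near _ L)) few) (Any.map⁻ far))

Settled-functional : ∀ {n} {A : Fin n → Fin n → Bool} {b} {c : Fin n × List ℕ} {a a′} →
  (∃ λ L → Chain A (proj₁ c) b L × map proj₂ L ≡ proj₂ c × Arrives (A ∖ faults L) (proj₁ c) a b) →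
  (∃ λ L → Chain A (proj₁ c) b L × map proj₂ L ≡ proj₂ c × Arrives (A ∖ faults L) (proj₁ c) a′ b) → a ≡ a′
Settled-functional (L , c , eq , arrives {P} bP p) (L′ , c′ , eq′ , arrives {P′} bP′ p′)
  with Chain-functional c c′ (trans eq (≡-sym eq′))
... | refl with ∷ʳ-injective P P′ (Best-unique bP bP′)
...   | refl , _ = Path-end-unique p p′

-- At most m / D elements satisfy P.
Sparse : ∀ {A : Set} → ℕ → (A → Set) → ℕ → Set
Sparse D P m = ∀ X → Unique X → All P X → length X * D ≤ m

-- The implications about `All (x ≢_)` say that the parts contain nothing outside `X`; the induction
-- needs this to keep them free of duplicates.
All-⊎-split : ∀ {A : Set} {P Q : A → Set} {X} → Unique X → All (λ x → P x ⊎ Q x) X →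
  ∃₂ λ Y Z → (Unique Y × All P Y × (∀ {x} → All (x ≢_) X → All (x ≢_) Y)) × (Unique Z × All Q Z × (∀ {x} → All (x ≢_) X → All (x ≢_) Z)) ×
    length X ≡ length Y + length Z
All-⊎-split [] [] = [] , [] , ([] , [] , id) , ([] , [] , id) , refl
All-⊎-split {X = x ∷ X} (x≢ ∷ uniq) (pq ∷ pqs) with All-⊎-split uniq pqs
All-⊎-split (x≢ ∷ uniq) (inj₁ p ∷ pqs) | Y , Z , (uY , pY , dY) , (uZ , qZ , dZ) , len =
  _ ∷ Y , Z , (dY x≢ ∷ uY , p ∷ pY , λ { (y≢ ∷ ys) → y≢ ∷ dY ys }) , (uZ , qZ , λ { (_ ∷ ys) → dZ ys }) , cong suc len
All-⊎-split (x≢ ∷ uniq) (inj₂ q ∷ pqs) | Y , Z , (uY , pY , dY) , (uZ , qZ , dZ) , len =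
  Y , _ ∷ Z , (uY , pY , λ { (_ ∷ ys) → dY ys }) , (dZ x≢ ∷ uZ , q ∷ qZ , λ { (y≢ ∷ ys) → y≢ ∷ dZ ys }) ,
  trans (cong suc len) (≡-sym (+-suc (length Y) (length Z)))

Sparse-⊎ : ∀ {A : Set} {D} {P Q : A → Set} {m k} → Sparse D P m → Sparse D Q k → Sparse D (λ x → P x ⊎ Q x) (m + k)
Sparse-⊎ {D = D} sP sQ X uniq pqs with All-⊎-split uniq pqs
... | Y , Z , (uY , pY , _) , (uZ , qZ , _) , len = ≤-trans (≤-reflexive (trans (cong (_* D) len) (*-distribʳ-+ D (length Y) (length Z))))
  (+-mono-≤ (sP Y uY pY) (sQ Z uZ qZ))

Sparse-⇒ : ∀ {A : Set} {D} {P Q : A → Set} {m} → (∀ {x} → Q x → P x) → Sparse D P m → Sparse D Q m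
Sparse-⇒ Q⇒P sP X uniq qs = sP X uniq (All.map Q⇒P qs)

any-∃ : ∀ {A : Set} (p : A → Bool) xs → any p xs ≡ true → ∃ λ x → x ∈ xs × p x ≡ true
any-∃ p (x ∷ xs) eq with p x in px
... | true  = x , here refl , px
... | false with any-∃ p xs eq
...   | y , y∈ , py = y , there y∈ , py

filterᵇ-true : ∀ {A : Set} (p : A → Bool) xs → All (λ x → p x ≡ true) (filterᵇ p xs)
filterᵇ-true p [] = []
filterᵇ-true p (x ∷ xs) with p x in px
... | true  = px ∷ filterᵇ-true p xs
... | false = filterᵇ-true p xs

witnesses : ∀ {A : Set} {P : A → Set} {X} → All P X → ∃ λ (Y : List (∃ P)) → map proj₁ Y ≡ X
witnesses []       = [] , refl
witnesses (p ∷ ps) with witnesses ps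
... | Y , eq = (_ , p) ∷ Y , cong (_ ∷_) eq

does-true : ∀ {P : Set} (P? : Dec P) → does P? ≡ true → P
does-true (yes p) _ = p

hits : ∀ {n t} → (Fin t → Fin n) → Fin n → Bool
hits f r = does (anyF? (λ i → f i ≟F r))

hits⁻ : ∀ {n t} (f : Fin t → Fin n) {r} → hits f r ≡ true → ∃ λ i → f i ≡ r
hits⁻ f {r} = does-true (anyF? (λ i → f i ≟F r))

hits⁺ : ∀ {n t} (f : Fin t → Fin n) i → hits f (f i) ≡ true
hits⁺ f i = dec-true (anyF? (λ j → f j ≟F f i)) (i , refl)

countList-hits : ∀ {n t} {f : Fin t → Fin n} → (∀ {i j} → f i ≡ f j → i ≡ j) → t ≤ countList (hits f) (allFin n)
countList-hits {n} {t} {f} inj = subst₂ _≤_ (length-allFin t) (length-filterᵇ (hits f) (allFin n))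
  (length-≤-codes {R = λ i r → f i ≡ r} (λ { refl eq → inj (≡-sym eq) }) (filterᵇ (hits f) (allFin n)) (Unique.allFin⁺ t)
    (All.tabulate (λ {i} _ → f i , ∈-filter⁺ (λ r → T? (hits f r)) (∈-allFin (f i)) (subst T (≡-sym (hits⁺ f i)) tt) , refl)))

-- A greedily chosen set of at most 2 n / t vertices serves as sources for half of the elements.
Sparse-Spread : ∀ {n} {A : Fin n → Fin n → Bool} {b D t g m} → 0 < t →
  (∀ S → length S * t ≤ 2 * n → Sparse D (Reached A S g b) m) → Sparse D (λ a → Spread A t g a b) (2 * m)
Sparse-Spread {n} {A} {b} {D} {t} {g} {m} 0<t claim X uniq spreads with witnesses spreads
... | Y , refl with greedy-hitting 0<t h (length Y) (length Y) Y ≤-refl (All.tabulate (λ {y} _ → countList-hits (Spread.injective (proj₂ y))))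
  where
  h : ∃ (λ a → Spread A t g a b) → Fin n → Bool
  h y = hits (Spread.source (proj₂ y))
...   | R , cost , rest = begin
  length (map proj₁ Y) * D     ≡⟨ cong (_* D) (length-map proj₁ Y) ⟩
  length Y * D                 ≤⟨ *-monoˡ-≤ D half ⟩
  2 * covered * D              ≡⟨ *-assoc 2 covered D ⟩
  2 * (covered * D)            ≤⟨ *-monoʳ-≤ 2 bound ⟩
  2 * m                        ∎
  where
  open ≤-Reasoning
  h : ∃ (λ a → Spread A t g a b) → Fin n → Bool
  h y = hits (Spread.source (proj₂ y))

  hit? : ∃ (λ a → Spread A t g a b) → Bool
  hit? y = any (h y) R

  covered : ℕ
  covered = countList hit? Y

  half : length Y ≤ 2 * covered
  half = +-cancelʳ-≤ (length Y) (length Y) (2 * covered) (begin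
    length Y + length Y                          ≡⟨ cong (length Y +_) (+-identityʳ (length Y)) ⟨
    2 * length Y                                 ≡⟨ cong (2 *_) (countList-not hit? Y) ⟨
    2 * (covered + countList (not ∘ hit?) Y)     ≡⟨ *-distribˡ-+ 2 covered _ ⟩
    2 * covered + 2 * countList (not ∘ hit?) Y   ≤⟨ +-monoʳ-≤ (2 * covered) rest ⟩
    2 * covered + length Y                       ∎)

  reached : ∀ {y} → hit? y ≡ true → Reached A R g b (proj₁ y)
  reached {a , spread source _ arrival} eq with any-∃ (hits source) R eq
  ... | r , r∈ , hr with hits⁻ source hr
  ...   | i , refl = source i , r∈ , arrival i

  Z : List (Fin n)
  Z = map proj₁ (filterᵇ hit? Y)

  -- The cost is charged to the covered items, of which there are at most `length Y`; cancelling
  -- this number leaves the bound that `claim` asks of `R`.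
  small : ∀ y → length R * (t * y) ≤ 2 * n * y → 0 < y → length R * t ≤ 2 * n
  small (suc y) le _ = *-cancelʳ-≤ (length R * t) (2 * n) (suc y) (≤-trans (≤-reflexive (*-assoc (length R) t (suc y))) le)

  bound : covered * D ≤ m
  bound with m≤n⇒m<n∨m≡n (z≤n {covered})
  ... | inj₂ none = subst (λ k → k * D ≤ m) none z≤n
  ... | inj₁ some = subst (λ k → k * D ≤ m) (trans (length-map proj₁ (filterᵇ hit? Y)) (length-filterᵇ hit? Y))
    (claim R (small (length Y) (≤-trans cost (*-monoʳ-≤ (2 * n) covered≤)) (≤-trans some covered≤)) Z
      (AllPairs.map⁺ (AllPairs.filter⁺ (λ y → T? (hit? y)) (AllPairs.map⁻ uniq)))
      (All.map⁺ (All.map (λ {y} → reached {y}) (filterᵇ-true hit? Y))))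
    where
    covered≤ : covered ≤ length Y
    covered≤ = subst (covered ≤_) (countList-not hit? Y) (m≤m+n covered _)

-- Induction on the number of faults

farFactor : ℕ → ℕ
farFactor zero    = 0
farFactor (suc f) = farFactor f + 2 * (2 * suc f ! + farFactor f)

-- `farFactor f` unfolds to the sum of 2 `factor g` over g < f, each 2 being the loss in
-- `Sparse-Spread`. The 2 before the factorial stems from the bound 2 `n` on the sources.
factor : ℕ → ℕ
factor f = 2 * suc f ! + farFactor f

-- Strong induction on `f`, bounded by `k`. The condition on `S` reproduces itself: at the threshold
-- `D ^ (2 ^ g)`, the hitting set of `Sparse-Spread` satisfies exactly this condition with `g` in
-- place of `f`.
Sparse-Reached : ∀ {n D} {A : Fin n → Fin n → Bool} {b} → 0 < D → ∀ k f → f < k → ∀ S → length S * D ^ (2 ^ f) ≤ 2 * n →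
  Sparse D (Reached A S f b) (factor f * n)
Sparse-Reached {n} {D} {A} {b} 0<D (suc k) f (s≤s f≤k) S S≤ = subst (Sparse D (Reached A S f b))
  (≡-sym (*-distribʳ-+ n (2 * suc f !) (farFactor f)))
  (Sparse-⇒ {P = λ a → Settled A S (codes D f) b a ⊎ (∃ λ g → g < f × Spread A (D ^ (2 ^ g)) g a b)} (classify D) (Sparse-⊎ settled (far f f≤k)))
  where
  open ≤-Reasoning
  settled : Sparse D (Settled A S (codes D f) b) (2 * suc f ! * n)
  settled X uniq all = begin
    length X * D                                 ≤⟨ *-monoˡ-≤ D (length-≤-codes Settled-functional (cartesianProduct S (codes D f)) uniq all) ⟩
    length (cartesianProduct S (codes D f)) * D  ≡⟨ cong (_* D) (length-cartesianProductWith _,_ S (codes D f)) ⟩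
    length S * length (codes D f) * D            ≡⟨ *-assoc (length S) _ D ⟩
    length S * (length (codes D f) * D)          ≤⟨ *-monoʳ-≤ (length S) (length-codes 0<D f) ⟩
    length S * (suc f ! * D ^ (2 ^ f))           ≡⟨ *-left-comm (length S) (suc f !) _ ⟩
    suc f ! * (length S * D ^ (2 ^ f))           ≤⟨ *-monoʳ-≤ (suc f !) S≤ ⟩
    suc f ! * (2 * n)                            ≡⟨ *-left-comm (suc f !) 2 n ⟩
    2 * (suc f ! * n)                            ≡⟨ *-assoc 2 (suc f !) n ⟨
    2 * suc f ! * n                              ∎

  far : ∀ f → f ≤ k → Sparse D (λ a → ∃ λ g → g < f × Spread A (D ^ (2 ^ g)) g a b) (farFactor f * n)
  far zero    _    [] _ _ = z≤n
  far zero    _    (_ ∷ _) _ ((_ , () , _) ∷ _)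
  far (suc f) f<k = subst (Sparse D _) eq
    (Sparse-⇒ {P = λ a → (∃ λ g → g < f × Spread A (D ^ (2 ^ g)) g a b) ⊎ Spread A (D ^ (2 ^ f)) f a b} cases
      (Sparse-⊎ (far f (<⇒≤ f<k)) (Sparse-Spread (0<^ 0<D (2 ^ f)) (Sparse-Reached 0<D k f f<k))))
    where
    eq : farFactor f * n + 2 * (factor f * n) ≡ farFactor (suc f) * n
    eq = trans (cong (farFactor f * n +_) (≡-sym (*-assoc 2 (factor f) n))) (≡-sym (*-distribʳ-+ n (farFactor f) (2 * factor f)))
    cases : ∀ {a} → (∃ λ g → g < suc f × Spread A (D ^ (2 ^ g)) g a b) →
      (∃ λ g → g < f × Spread A (D ^ (2 ^ g)) g a b) ⊎ Spread A (D ^ (2 ^ f)) f a b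
    cases (g , s≤s g≤f , sp) with m≤n⇒m<n∨m≡n g≤f
    ... | inj₁ g<f  = inj₁ (g , g<f , sp)
    ... | inj₂ refl = inj₂ sp

-- The preserver

sources : ∀ {n} → Subset n → List (Fin n)
sources []            = []
sources (outside ∷ S) = map Fin.suc (sources S)
sources (inside ∷ S)  = Fin.zero ∷ map Fin.suc (sources S)

length-sources : ∀ {n} (S : Subset n) → length (sources S) ≡ ∣ S ∣
length-sources []            = refl
length-sources (outside ∷ S) = trans (length-map Fin.suc (sources S)) (length-sources S)
length-sources (inside ∷ S)  = cong suc (trans (length-map Fin.suc (sources S)) (length-sources S))

∈-sources : ∀ {n} {S : Subset n} {s} → s ∈S S → s ∈ sources S
∈-sources here = here refl
∈-sources {S = outside ∷ S} (there s∈) = ∈-map⁺ Fin.suc (∈-sources s∈)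
∈-sources {S = inside ∷ S}  (there s∈) = there (∈-map⁺ Fin.suc (∈-sources s∈))

arrives? : ∀ {n} (A : Fin n → Fin n → Bool) s a b → Dec (Arrives A s a b)
arrives? A s a b with best? A s b
... | no ¬best = no λ { (arrives bP _) → ¬best (_ , bP) }
... | yes (R , bR) with best? A s a
...   | no ¬best = no λ { (arrives {P} bP p) → ¬best (_ , Best-take P bP p) }
...   | yes (P , bP) with ≡-dec _≟F_ R (P ∷ʳ b)
...     | yes refl = yes (arrives bR (path bP))
...     | no R≢ = no λ { (arrives {Q} bQ q) →
            R≢ (trans (Best-unique bR bQ) (cong (_∷ʳ b) (Best-unique (Best-take Q bQ q) bP))) }

Arrives⇒edge : ∀ {n} {A : Fin n → Fin n → Bool} {s a b} → Arrives A s a b → A a b ≡ true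
Arrives⇒edge (arrives {P} bP p) with Best-drop P bP p
... | best (e ∷ []) _ = e

reached? : ∀ {n} (A : Fin n → Fin n → Bool) S f b a → Dec (Reached A S f b a)
reached? {n} A S f b a = map′ to from (any? (λ s → any? (arrivesFT? s) (listsUpTo edges f)) S)
  where
  edges : List (Fin n × Fin n)
  edges = cartesianProduct (allFin n) (allFin n)

  arrivesFT? : ∀ s F → Dec (length F ≤ f × Arrives (A ∖ F) s a b)
  arrivesFT? s F = (length F ≤? f) ×-dec arrives? (A ∖ F) s a b

  to : Any (λ s → Any (λ F → length F ≤ f × Arrives (A ∖ F) s a b) (listsUpTo edges f)) S → Reached A S f b a
  to found with find found
  ... | s , s∈ , found′ with find found′
  ...   | F , _ , F≤f , arr = s , s∈ , F , F≤f , arr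

  from : Reached A S f b a → Any (λ s → Any (λ F → length F ≤ f × Arrives (A ∖ F) s a b) (listsUpTo edges f)) S
  from (s , s∈ , F , F≤f , arr) = lose s∈
    (lose (∈-listsUpTo (λ (u , v) → ∈-cartesianProduct⁺ (∈-allFin u) (∈-allFin v)) F F≤f) (F≤f , arr))

module Preserver {n : ℕ} (f : ℕ) (G : Graph n) (S : Subset n) where

  arc : Fin n → Fin n → Bool
  arc a b = does (reached? (adj G) (sources S) f b a)

  arc⁻ : ∀ {a b} → arc a b ≡ true → Reached (adj G) (sources S) f b a
  arc⁻ {a} {b} = does-true (reached? (adj G) (sources S) f b a)

  arc⇒adj : ∀ {a b} → arc a b ≡ true → adj G a b ≡ true
  arc⇒adj eq with arc⁻ eq
  ... | s , _ , F , _ , arr = proj₁ (∖⁻ (adj G) F (Arrives⇒edge arr))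

  adj-irrefl : ∀ {u} → adj G u u ≢ true
  adj-irrefl {u} eq = contradiction (trans (≡-sym eq) (irrefl G u)) (λ ())

  H : Graph n
  H = record
    { adj    = λ a b → arc a b ∨ arc b a
    ; sym    = λ a b → ∨-comm (arc a b) (arc b a)
    ; irrefl = no-loop
    }
    where
    no-loop : ∀ u → arc u u ∨ arc u u ≡ false
    no-loop u with arc u u in eq
    ... | true  = contradiction (arc⇒adj eq) adj-irrefl
    ... | false = refl

  H⊆G : H ⊆G G
  H⊆G a b eq with arc a b in ab
  ... | true  = arc⇒adj ab
  ... | false = trans (Graph.sym G a b) (arc⇒adj eq)

  -- Each edge of `Q` ends a prefix of a path optimal under `F`, and so is an arc. `F` defines the
  -- optimality, while `K` is the set actually avoided, which may contain one more fault.
  H-path : ∀ {s x} F K → s ∈S S → length F ≤ f → ∀ P Q {w} → Best (adj G ∖ F) s x (P ++ Q) → Path (adj G ∖ F) s P w →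
    Path (adj G ∖ K) w Q x → Path (adj H ∖ K) w Q x
  H-path F K s∈ F≤f P [] b p [] = []
  H-path {s} {x} F K s∈ F≤f P (y ∷ Q) {w} b p (e ∷ q) =
    ∖⁺ (adj H) K wy (proj₂ (∖⁻ (adj G) K e)) ∷ H-path F K s∈ F≤f (P ∷ʳ y) Q b′ p′ q
    where
    b′ : Best (adj G ∖ F) s x ((P ∷ʳ y) ++ Q)
    b′ = subst (Best _ s x) (≡-sym (∷ʳ-++ P _ _)) b
    p′ : Path (adj G ∖ F) s (P ∷ʳ y) y
    p′ with path (Best-drop P b p)
    ... | e′ ∷ _ = Path-++ p (e′ ∷ [])
    wy : adj H w y ≡ true
    wy rewrite dec-true (reached? (adj G) (sources S) f y w) (s , ∈-sources s∈ , F , F≤f , arrives (Best-take (P ∷ʳ y) b′ p′) p) = refl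

  -- The head of the fault list is the extra fault, left to `restore`; the others number at most
  -- `f`, and the halves optimal under them lie in `H`.
  preserve : ∀ F → length F ≤ suc f → ∀ {s t Z} → s ∈S S → t ∈S S → Path (adj G ∖ F) s Z t →
    (∀ {R} → Path (adj G ∖ F) s R t → length Z ≤ length R) → ∃ λ R → Path (adj H ∖ F) s R t × length R ≡ length Z
  preserve [] F≤ s∈ t∈ z shortest with Best-exists z
  ... | P , bP = P , H-path [] [] s∈ z≤n [] P bP [] (path bP) , ≤-antisym (Best-length bP z) (shortest (path bP))
  preserve (e ∷ F) (s≤s F≤f) {s} {t} {Z} s∈ t∈ z shortest
    with restore {A = adj G ∖ F} (∖-sym (Graph.sym G) F) e (Path-⊑ (++-⊑-∖∖ F (e ∷ [])) z)
           (λ r → shortest (Path-⊑ (∖∖-⊑-++ F (e ∷ [])) r))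
  ... | restored P Q bP bQ p q total with Path-reverse (∖-sym (Graph.sym H) (e ∷ F))
          (H-path F (e ∷ F) t∈ F≤f [] Q bQ [] (Path-⊑ (∖∖-⊑-++ F (e ∷ [])) q))
  ...   | Q⁻ , q⁻ , len = P ++ Q⁻ ,
          Path-++ (H-path F (e ∷ F) s∈ F≤f [] P bP [] (Path-⊑ (∖∖-⊑-++ F (e ∷ [])) p)) q⁻ ,
          trans (length-++ P) (trans (cong (length P +_) len) total)

Walk⇒Path : ∀ {n} {A : Fin n → Fin n → Bool} {u v ℓ} → Walk A u v ℓ → ∃ λ P → Path A u P v × length P ≡ ℓ
Walk⇒Path nil = [] , [] , refl
Walk⇒Path (cons e w) with Walk⇒Path w
... | P , p , len = _ ∷ P , e ∷ p , cong suc len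

Path⇒Walk : ∀ {n} {A : Fin n → Fin n → Bool} {u v P} → Path A u P v → Walk A u v (length P)
Path⇒Walk []      = nil
Path⇒Walk (e ∷ p) = cons e (Path⇒Walk p)

Preserver-correct : ∀ {n} f (G : Graph n) S → FTPreserver (suc f) G (Preserver.H f G S) S
Preserver-correct f G S = H⊆G , λ F F≤ s t s∈ t∈ d → mk⇔ (H⇒G F F≤ s∈ t∈) (G⇒H F F≤ s∈ t∈)
  where
  open Preserver f G S

  sub : ∀ F → adj H ∖ F ⊑ adj G ∖ F
  sub F u v eq with ∖⁻ (adj H) F eq
  ... | h , nf = ∖⁺ (adj G) F (H⊆G u v h) nf

  H-walk : ∀ F → length F ≤ suc f → ∀ {s t d} → s ∈S S → t ∈S S → IsDist (removeAdj G F) s t d → Walk (removeAdj H F) s t d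
  H-walk F F≤ s∈ t∈ (w , min) with Walk⇒Path w
  ... | Z , z , refl with preserve F F≤ s∈ t∈ z (λ r → min _ (Path⇒Walk r))
  ...   | R , r , len = subst (Walk _ _ _) len (Path⇒Walk r)

  lift : ∀ F {s t ℓ} → Walk (removeAdj H F) s t ℓ → Walk (removeAdj G F) s t ℓ
  lift F w with Walk⇒Path w
  ... | P , p , refl = Path⇒Walk (Path-⊑ (sub F) p)

  G⇒H : ∀ F → length F ≤ suc f → ∀ {s t d} → s ∈S S → t ∈S S → IsDist (removeAdj G F) s t d → IsDist (removeAdj H F) s t d
  G⇒H F F≤ s∈ t∈ dist@(w , min) = H-walk F F≤ s∈ t∈ dist , λ ℓ w′ → min ℓ (lift F w′)

  H⇒G : ∀ F → length F ≤ suc f → ∀ {s t d} → s ∈S S → t ∈S S → IsDist (removeAdj H F) s t d → IsDist (removeAdj G F) s t d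
  H⇒G F F≤ {s} {t} {d} s∈ t∈ (w , min) with Walk⇒Path (lift F w)
  -- The lifted walk shows that `G` has a finite distance too; `H-walk` realises it in `H`, so `d`
  -- does not exceed it.
  ... | Z , z , refl with Best-exists z
  ...   | P , bP = lift F w , λ ℓ w′ → ≤-trans (min _ (H-walk F F≤ s∈ t∈ (Path⇒Walk (path bP) , λ ℓ w″ → P≤ w″))) (P≤ w′)
    where
    P≤ : ∀ {ℓ} → Walk (removeAdj G F) s t ℓ → length P ≤ ℓ
    P≤ w with Walk⇒Path w
    ... | R , r , refl = Best-length bP r

-- Counting the edges of the preserver

countList-mono : ∀ {A : Set} {p q : A → Bool} → (∀ x → p x ≡ true → q x ≡ true) → ∀ xs → countList p xs ≤ countList q xs
countList-mono p⇒q [] = z≤n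
countList-mono {p = p} {q} p⇒q (x ∷ xs) with p x in px | q x in qx
... | true  | true  = s≤s (countList-mono p⇒q xs)
... | true  | false = contradiction (trans (≡-sym qx) (p⇒q x px)) (λ ())
... | false | true  = m≤n⇒m≤1+n (countList-mono p⇒q xs)
... | false | false = countList-mono p⇒q xs

countList-∨-≤ : ∀ {A : Set} (p q : A → Bool) xs → countList (λ x → p x ∨ q x) xs ≤ countList p xs + countList q xs
countList-∨-≤ p q [] = z≤n
countList-∨-≤ p q (x ∷ xs) with p x
... | true  = s≤s (≤-trans (countList-∨-≤ p q xs) (+-monoʳ-≤ (countList p xs) (m≤n+m _ (if q x then 1 else 0))))
... | false = ≤-trans (+-monoʳ-≤ (if q x then 1 else 0) (countList-∨-≤ p q xs))
  (≤-reflexive (+-left-comm (if q x then 1 else 0) (countList p xs) _))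

sumList-*-≤ : ∀ {A : Set} {c : A → ℕ} {D m} → (∀ x → c x * D ≤ m) → ∀ xs → sumList c xs * D ≤ length xs * m
sumList-*-≤ bound [] = z≤n
sumList-*-≤ {c = c} {D} {m} bound (x ∷ xs) = subst (_≤ m + length xs * m) (≡-sym (*-distribʳ-+ D (c x) (sumList c xs)))
  (+-mono-≤ (bound x) (sumList-*-≤ bound xs))

-- Every edge is an arc in at least one direction, and outdegrees and indegrees have the same sum.
-- Counting without the order test costs at most a factor 2; `Sparse-Reached` bounds each indegree.
numEdges-bound : ∀ {n} f (G : Graph n) S {D} → 0 < D → ∣ S ∣ * D ^ (2 ^ f) ≤ 2 * n →
  numEdges (Preserver.H f G S) * D ≤ 2 * (n * (factor f * n))
numEdges-bound {n} f G S {D} 0<D S≤ = begin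
  numEdges H * D                                           ≤⟨ *-monoˡ-≤ D edges≤ ⟩
  (sumList outdeg V + sumList indeg V) * D                 ≡⟨ cong (λ k → (k + sumList indeg V) * D) (countList-swap arc V V) ⟩
  (sumList indeg V + sumList indeg V) * D                  ≡⟨ cong (λ k → (sumList indeg V + k) * D) (+-identityʳ (sumList indeg V)) ⟨
  2 * sumList indeg V * D                                  ≡⟨ *-assoc 2 (sumList indeg V) D ⟩
  2 * (sumList indeg V * D)                                ≤⟨ *-monoʳ-≤ 2 (sumList-*-≤ indeg-bound V) ⟩
  2 * (length V * (factor f * n))                          ≡⟨ cong (λ k → 2 * (k * (factor f * n))) (length-allFin n) ⟩
  2 * (n * (factor f * n))                                 ∎
  where
  open ≤-Reasoning
  open Preserver f G S

  V : List (Fin n)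
  V = allFin n

  outdeg indeg : Fin n → ℕ
  outdeg u = countList (arc u) V
  indeg b  = countList (λ a → arc a b) V

  indeg-bound : ∀ b → indeg b * D ≤ factor f * n
  indeg-bound b = subst (λ k → k * D ≤ factor f * n) (length-filterᵇ (λ a → arc a b) V)
    (Sparse-Reached 0<D (suc f) f ≤-refl (sources S) (subst (λ k → k * D ^ (2 ^ f) ≤ 2 * n) (≡-sym (length-sources S)) S≤)
      (filterᵇ (λ a → arc a b) V) (Unique.filter⁺ (λ a → T? (arc a b)) (Unique.allFin⁺ n))
      (All.map arc⁻ (filterᵇ-true (λ a → arc a b) V)))

  edges≤ : numEdges H ≤ sumList outdeg V + sumList indeg V
  edges≤ = ≤-trans
    (sumList-mono (λ u → ≤-trans (countList-mono (λ v → ∧-conicalʳ _ _) V) (countList-∨-≤ (arc u) (λ v → arc v u) V)) V)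
    (≤-reflexive (sumList-+ outdeg indeg V))

-- Choice of `D` and the final estimate

^-distribʳ-* : ∀ m n o → (m * n) ^ o ≡ m ^ o * n ^ o
^-distribʳ-* m n zero    = refl
^-distribʳ-* m n (suc o) = trans (cong (m * n *_) (^-distribʳ-* m n o)) (*-interchange m n (m ^ o) (n ^ o))

m≤m^n : ∀ m {n} → 0 < n → m ≤ m ^ n
m≤m^n zero    _   = z≤n
m≤m^n (suc m) 0<n = ≤-trans (≤-reflexive (≡-sym (*-identityʳ (suc m)))) (^-monoʳ-≤ (suc m) 0<n)

-- For the predicate used in the theorem, this yields the integer part of the `q`-th root of n /
-- |S|.
crossover : ∀ {P : ℕ → Set} → (∀ k → Dec (P k)) → P 1 → ∀ m → ¬ P (suc m) → ∃ λ k → 0 < k × P k × ¬ P (suc k)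
crossover P? p₁ zero    ¬p = contradiction p₁ ¬p
crossover P? p₁ (suc m) ¬p with P? (suc m)
... | yes p = suc m , s≤s z≤n , p , ¬p
... | no ¬p′ = crossover P? p₁ m ¬p′

0^n≡0 : ∀ {n} → 0 < n → 0 ^ n ≡ 0
0^n≡0 {suc n} _ = refl

-- Rounding the root down is harmless: `suc D` is at most `D + D`, which accounts for the 2 in
-- `2 * K`.
edge-arithmetic : ∀ {E K n D q k} → 0 < q → 0 < n → 0 < D → E * D ≤ K * (n * n) → n < suc D ^ q * k →
  E ^ q * n ≤ (2 * K) ^ q * (n ^ (q + q) * k)
edge-arithmetic {E} {K} {n} {D} {q} {k} 0<q 0<n 0<D ED≤ n< = begin
  E ^ q * n                          ≤⟨ *-monoʳ-≤ (E ^ q) (<⇒≤ n<) ⟩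
  E ^ q * (suc D ^ q * k)            ≡⟨ *-assoc (E ^ q) (suc D ^ q) k ⟨
  E ^ q * suc D ^ q * k              ≡⟨ cong (_* k) (^-distribʳ-* E (suc D) q) ⟨
  (E * suc D) ^ q * k                ≤⟨ *-monoˡ-≤ k (^-monoˡ-≤ q E[1+D]≤) ⟩
  (2 * K * (n * n)) ^ q * k          ≡⟨ cong (_* k) (^-distribʳ-* (2 * K) (n * n) q) ⟩
  (2 * K) ^ q * (n * n) ^ q * k      ≡⟨ *-assoc ((2 * K) ^ q) ((n * n) ^ q) k ⟩
  (2 * K) ^ q * ((n * n) ^ q * k)    ≡⟨ cong (λ m → (2 * K) ^ q * (m * k)) (trans (^-distribʳ-* n n q) (≡-sym (^-distribˡ-+-* n q q))) ⟩
  (2 * K) ^ q * (n ^ (q + q) * k)    ∎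
  where
  open ≤-Reasoning
  E[1+D]≤ : E * suc D ≤ 2 * K * (n * n)
  E[1+D]≤ = begin
    E * suc D               ≤⟨ *-monoʳ-≤ E (+-monoˡ-≤ D 0<D) ⟩
    E * (D + D)             ≡⟨ *-distribˡ-+ E D D ⟩
    E * D + E * D           ≤⟨ +-mono-≤ ED≤ ED≤ ⟩
    K * (n * n) + K * (n * n) ≡⟨ double K (n * n) ⟩
    2 * K * (n * n)         ∎
    where
    double : ∀ a b → a * b + a * b ≡ 2 * a * b
    double = solve-∀

-- Raising the bound to the power 2^f clears the fractional exponents: 2 - 1/2^f becomes 2^(f+1) -
-- 1, and |S| gets exponent 1.
theorem26 : (f : ℕ) → ∃[ C ] ((n : ℕ) (G : Graph n) (S : Subset n) →
    ∃[ H ] (FTPreserver (suc f) G H S ×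
    numEdges H ^ (2 ^ f) ≤ C * (n ^ (2 ^ suc f ∸ 1) * ∣ S ∣)))
theorem26 f = (2 * (2 * factor f)) ^ (2 ^ f) , λ n G S → Preserver.H f G S , Preserver-correct f G S , bound n G S
  where
  q : ℕ
  q = 2 ^ f

  0<q : 0 < q
  0<q = m^n>0 2 f

  regroup : ∀ x y → 2 * (x * (y * x)) ≡ 2 * y * (x * x)
  regroup = solve-∀

  bound : ∀ n G S → numEdges (Preserver.H f G S) ^ q ≤ (2 * (2 * factor f)) ^ q * (n ^ (2 ^ suc f ∸ 1) * ∣ S ∣)
  bound n G S with m≤n⇒m<n∨m≡n (z≤n {∣ S ∣})
  -- Without sources `D` is unconstrained; taking it above the whole right-hand side forces the edge
  -- count to be 0.
  ... | inj₂ S≡0 = ≤-trans (≤-reflexive (trans (cong (_^ q) no-edges) (0^n≡0 0<q))) z≤n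
    where
    M : ℕ
    M = 2 * (n * (factor f * n))
    no-edges : numEdges (Preserver.H f G S) ≡ 0
    no-edges = small (numEdges (Preserver.H f G S)) (numEdges-bound f G S {suc M} (s≤s z≤n) (subst (λ k → k * suc M ^ q ≤ 2 * n) S≡0 z≤n))
      where
      small : ∀ E → E * suc M ≤ M → E ≡ 0
      small zero    _  = refl
      small (suc E) le = contradiction (≤-trans (m≤m+n (suc M) (E * suc M)) le) (<-irrefl refl)
  -- The value 1 fits since |S| is at most `n`, and `suc n` does not.
  ... | inj₁ 0<S with crossover (λ D → D ^ q * ∣ S ∣ ≤? n)
          (subst (_≤ n) (≡-sym (trans (cong (_* ∣ S ∣) (^-zeroˡ q)) (*-identityˡ ∣ S ∣))) (∣p∣≤n S))
          n (<⇒≱ (≤-trans (m≤m^n (suc n) 0<q) (m≤m*n (suc n ^ q) ∣ S ∣ {{>-nonZero 0<S}})))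
  -- The estimate is proved multiplied by `n`, since `q + q` exceeds the exponent of `n` in the
  -- claim by 1.
  ...   | D , 0<D , fits , overflow = *-cancelʳ-≤ _ _ n {{>-nonZero 0<n}} (begin
    E ^ q * n                                          ≤⟨ edge-arithmetic {E} {2 * factor f} 0<q 0<n 0<D edges (≰⇒> overflow) ⟩
    C * (n ^ (q + q) * k)                              ≡⟨ cong (λ m → C * (n ^ m * k)) q+q≡ ⟩
    C * (n * n ^ (2 ^ suc f ∸ 1) * k)                  ≡⟨ pull-out C n (n ^ (2 ^ suc f ∸ 1)) k ⟩
    C * (n ^ (2 ^ suc f ∸ 1) * k) * n                  ∎)
    where
    open ≤-Reasoning
    E = numEdges (Preserver.H f G S)
    k = ∣ S ∣
    C = (2 * (2 * factor f)) ^ q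
    0<n : 0 < n
    0<n = ≤-trans 0<S (∣p∣≤n S)
    edges : E * D ≤ 2 * factor f * (n * n)
    edges = ≤-trans
      (numEdges-bound f G S 0<D (≤-trans (≤-reflexive (*-comm k (D ^ q))) (≤-trans fits (m≤m+n n (n + 0)))))
      (≤-reflexive (regroup n (factor f)))
    q+q≡ : q + q ≡ suc (2 ^ suc f ∸ 1)
    q+q≡ = trans (cong (q +_) (≡-sym (+-identityʳ q))) (≡-sym (suc-pred (2 ^ suc f) {{>-nonZero (m^n>0 2 (suc f))}}))
    pull-out : ∀ c x y z → c * (x * y * z) ≡ c * (y * z) * x
    pull-out = solve-∀
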